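{- Let $\ell_1\leq\ell_2\leq\ell_3\leq\ell_4$ be positive integers and $e=\ell_1+\ell_2+\ell_3+\ell_4$. Then $$\lambda(S_{1,1,1,\ell_4})=\begin{cases}4&\text{if }e\leq10;\\ \left\lceil\frac{ -1+\sqrt{8e+9}}{2}\right\rceil&\text{if }e\geq11\text{ and }\left\lceil\frac{ -1+\sqrt{8e+9}}{2}\right\rceil\text{ is odd};\\ \left\lceil\sqrt{2e-4}\right\rceil&\text{otherwise,}\end{cases}$$ and if $\ell_3\geq2$, then $$\lambda(S_{\ell_1,\ell_2,\ell_3,\ell_4})=\begin{cases}4&\text{if }e\leq10\text{ and }\ell_1=1;\\5&\text{if }e\leq10\text{ and }\ell_1=2;\\ \left\lceil\frac{ -1+\sqrt{8e+1}}{2}\right\rceil&\text{if }e\geq11\text{ and }\left\lceil\frac{ -1+\sqrt{8e+1}}{2}\right\rceil\text{ is odd};\\ \left\lceil\sqrt{2e-4}\right\rceil&\text{otherwise.}\end{cases}$$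
   Context: For a graph $G$, the edge-distinguishing chromatic number $\lambda(G)$ is the minimum positive integer $k$ for which there is a vertex coloring $c:V(G)\to\{1,\dotsc,k\}$ such that the edge labels $\{c(u),c(v)\}$ are distinct for distinct edges $uv$. The spider graph $S_{\ell_1,\ell_2,\ell_3,\ell_4}$ is the tree with central vertex $x_0$ and four paths (legs) $x_0x^i_1\dotsb x^i_{\ell_i}$, $i=1,\dotsc,4$, of $\ell_i$ edges each, sharing only $x_0$; it has $\ell_1+\ell_2+\ell_3+\ell_4$ edges. -}

module Defs where

open import Data.Nat using (ℕ; zero; suc; _+_; _*_; _≤_; _≤ᵇ_)
open import Data.Bool using (Bool; true; false; if_then_else_)
open import Data.Fin using (Fin; zero; suc; inject₁)
open import Data.Maybe using (Maybe; just; nothing)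
import Data.Maybe as Maybe
open import Data.Product using (Σ; _×_; _,_; ∃)
open import Data.Sum using (_⊎_)
open import Relation.Binary.PropositionalEquality using (_≡_)

record Graph : Set₁ where
  field
    V    : Set
    E    : Set
    end₁ : E → V
    end₂ : E → V
open Graph public

SameLabel : {k : ℕ} → Fin k → Fin k → Fin k → Fin k → Set
SameLabel a b c d = (a ≡ c × b ≡ d) ⊎ (a ≡ d × b ≡ c)

EdgeDistinguishing : (G : Graph) {k : ℕ} → (V G → Fin k) → Set
EdgeDistinguishing G c =
  (e f : E G) → SameLabel (c (end₁ G e)) (c (end₂ G e)) (c (end₁ G f)) (c (end₂ G f)) → e ≡ f

EDColorable : Graph → ℕ → Set
EDColorable G k = Σ (V G → Fin k) (EdgeDistinguishing G)

IsEDChromaticNumber : Graph → ℕ → Set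
IsEDChromaticNumber G k =
  1 ≤ k × EDColorable G k × ((m : ℕ) → 1 ≤ m → EDColorable G m → k ≤ m)

-- Spider S_{l₁,l₂,l₃,l₄}.  Vertex  nothing  is the centre x₀; vertex  just (i , j)
-- (j : Fin lᵢ) is x^i_{j+1}.  Edge (i , j) joins x^i_j (x₀ if j = 0) and x^i_{j+1}.
legs : ℕ → ℕ → ℕ → ℕ → Fin 4 → ℕ
legs l₁ l₂ l₃ l₄ zero = l₁
legs l₁ l₂ l₃ l₄ (suc zero) = l₂
legs l₁ l₂ l₃ l₄ (suc (suc zero)) = l₃
legs l₁ l₂ l₃ l₄ (suc (suc (suc zero))) = l₄

prevIdx : {n : ℕ} → Fin n → Maybe (Fin n)
prevIdx zero = nothing
prevIdx (suc j) = just (inject₁ j)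

Spider : ℕ → ℕ → ℕ → ℕ → Graph
Spider l₁ l₂ l₃ l₄ = record
  { V    = Maybe (Σ (Fin 4) (λ i → Fin (ℓ i)))
  ; E    = Σ (Fin 4) (λ i → Fin (ℓ i))
  ; end₁ = λ { (i , j) → Maybe.map (λ j′ → (i , j′)) (prevIdx j) }
  ; end₂ = λ { (i , j) → just (i , j) }
  }
  where ℓ = legs l₁ l₂ l₃ l₄

-- least k ≤ fuel (searching from `from`) with p k; returns the fuel bound if none.
leastFrom : (ℕ → Bool) → ℕ → ℕ → ℕ
leastFrom p from zero = from
leastFrom p from (suc fuel) = if p from then from else leastFrom p (suc from) fuel

-- ⌈√n⌉ = least k ∈ ℕ with n ≤ k² (k = n always qualifies).
ceilSqrt : ℕ → ℕ
ceilSqrt n = leastFrom (λ k → n ≤ᵇ k * k) 0 n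

-- ⌈(-1 + √m)/2⌉ = least k ∈ ℕ with (-1+√m)/2 ≤ k, i.e. m ≤ (2k+1)² (for m ≥ 1).
ceilHalfSqrtMinus1 : ℕ → ℕ
ceilHalfSqrtMinus1 m = leastFrom (λ k → m ≤ᵇ (2 * k + 1) * (2 * k + 1)) 0 m

{-# OPTIONS --safe #-}
module Submission where

-- An edge-distinguishing colouring with k colours traces four edge-disjoint walks from a common vertex in the
-- complete graph with loops K on {0, …, k−1}.
--
-- Lower bounds: each colour v is an end of at most k+1 edges of the spider (with multiplicity), and the parity of
-- this degree is that of the number of leaves coloured v. For even k at most four colours can attain k+1, so
-- 2e ≤ k² + 4. For odd k every colour of a single leaf loses one; in S(1,1,1,l) the first three leaves have
-- distinct colours, so at least two colours do.
--
-- Upper bounds, k odd: K splits into two closed trails through 0 of any lengths p, q ≥ 3, by induction on k: the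
-- edges at the two new vertices y, z form a closed trail through 0, which lengthens either trail. Cutting a closed
-- trail at a point and reversing the second half gives two legs, and the lengths p = l₂ + l₃, q = l₁ + l₄ give the
-- spider.
--
-- Upper bounds, k even: the same holds for K minus a perfect matching. The legs obtained from one closed trail end
-- at the same vertex m, and one of them is prolonged by the matching edge at m; the two trails can be cut so that
-- these matching edges differ. This uses k²/2 + 2 edges.

open import Defs
open import Data.Bool using (Bool; true; false; T)
open import Data.Empty using (⊥-elim)
open import Data.Fin as Fin using (Fin; toℕ; fromℕ<; fromℕ)
open import Data.Fin.Patterns using (0F; 1F; 2F; 3F)
open import Data.Fin.Properties as Fin using (any?; injective⇒≤; toℕ-fromℕ<; toℕ-inject₁; toℕ<n; toℕ-injective)
open import Data.List using (List; []; _∷_; _++_; [_]; length; concat; tabulate; take; drop)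
open import Data.List.Membership.Propositional using (_∈_; _∉_)
open import Data.List.Membership.Propositional.Properties using (∈-++⁺ʳ; ∈-concat⁺′; ∈-tabulate⁺)
open import Data.List.Properties using (length-++; ++-assoc; ++-identityʳ; take++drop≡id; length-take; length-drop)
open import Data.List.Relation.Binary.Disjoint.Propositional using (Disjoint)
open import Data.List.Relation.Binary.Permutation.Propositional as Perm
  using (_↭_; ↭-refl; ↭-trans; ↭-sym; ↭-reflexive; ↭⇒↭ₛ)
import Data.List.Relation.Binary.Permutation.Propositional.Properties as Perm
import Data.List.Relation.Binary.Permutation.Setoid.Properties as PermSetoid
open import Data.List.Relation.Unary.All as All using (All; []; _∷_)
import Data.List.Relation.Unary.All.Properties as All
open import Data.List.Relation.Unary.AllPairs using ([]; _∷_)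
open import Data.List.Relation.Unary.Any using (here; there)
open import Data.List.Relation.Unary.Unique.DecPropositional using (unique?)
open import Data.List.Relation.Unary.Unique.Propositional using (Unique)
import Data.List.Relation.Unary.Unique.Propositional.Properties as Unique
open import Data.Maybe as Maybe using (Maybe; just; nothing; maybe)
open import Data.Nat
open import Data.Nat.DivMod using (m≡m%n+[m/n]*n; m%n<n)
open import Data.Nat.Properties
open import Data.Nat.Tactic.RingSolver using (solve-∀)
open import Data.Product using (_×_; _,_; proj₁; proj₂; ∃; ∃₂)
open import Data.Product.Properties using (≡-dec)
open import Data.Sum using (_⊎_; inj₁; inj₂; [_,_]′)
open import Function using (_∘_; id)
open import Relation.Binary.PropositionalEquality hiding ([_])
open import Relation.Nullary using (Dec; ¬_; yes; no)
open import Relation.Nullary.Decidable using (True; toWitness; ¬?; _×-dec_; _→-dec_)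
open import Algebra.Properties.Semiring.Sum +-*-semiring using (sum; sum-cong-≗; ∑-distrib-+; ∑-comm; *-distribˡ-sum)

-- Lists without repetition

Unique-++⁻ : ∀ {A : Set} (xs : List A) {ys} → Unique (xs ++ ys) → Unique xs × Unique ys × Disjoint xs ys
Unique-++⁻ []       u       = [] , u , λ ()
Unique-++⁻ (x ∷ xs) (a ∷ u) with Unique-++⁻ xs u
... | uxs , uys , dis = All.++⁻ˡ xs a ∷ uxs , uys , λ where
  (here refl , y∈ys) → All.lookup (All.++⁻ʳ xs a) y∈ys refl
  (there x∈xs , y∈ys) → dis (x∈xs , y∈ys)

Unique-resp-↭ : ∀ {A : Set} {xs ys : List A} → xs ↭ ys → Unique xs → Unique ys
Unique-resp-↭ p = PermSetoid.Unique-resp-↭ (setoid _) (↭⇒↭ₛ p)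

Unique-concat-tabulate⁻ : ∀ {A : Set} n (f : Fin n → List A) → Unique (concat (tabulate f)) → ∀ i → Unique (f i)
Unique-concat-tabulate⁻ (suc n) f u Fin.zero    = proj₁ (Unique-++⁻ (f Fin.zero) u)
Unique-concat-tabulate⁻ (suc n) f u (Fin.suc i) =
  Unique-concat-tabulate⁻ n (f ∘ Fin.suc) (proj₁ (proj₂ (Unique-++⁻ (f Fin.zero) u))) i

∈-concat-tabulate : ∀ {A : Set} n (f : Fin n → List A) i {x} → x ∈ f i → x ∈ concat (tabulate f)
∈-concat-tabulate n f i x∈ = ∈-concat⁺′ x∈ (∈-tabulate⁺ i)

Unique-concat-tabulate⇒≡ : ∀ {A : Set} n (f : Fin n → List A) → Unique (concat (tabulate f)) →
  ∀ i j {x} → x ∈ f i → x ∈ f j → i ≡ j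
Unique-concat-tabulate⇒≡ (suc n) f u Fin.zero Fin.zero p q = refl
Unique-concat-tabulate⇒≡ (suc n) f u Fin.zero (Fin.suc j) p q =
  ⊥-elim (proj₂ (proj₂ (Unique-++⁻ (f Fin.zero) u)) (p , ∈-concat-tabulate n (f ∘ Fin.suc) j q))
Unique-concat-tabulate⇒≡ (suc n) f u (Fin.suc i) Fin.zero p q =
  ⊥-elim (proj₂ (proj₂ (Unique-++⁻ (f Fin.zero) u)) (q , ∈-concat-tabulate n (f ∘ Fin.suc) i p))
Unique-concat-tabulate⇒≡ (suc n) f u (Fin.suc i) (Fin.suc j) p q =
  cong Fin.suc (Unique-concat-tabulate⇒≡ n (f ∘ Fin.suc) (proj₁ (proj₂ (Unique-++⁻ (f Fin.zero) u))) i j p q)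

-- Walks, their labels and their reversal

-- A walk is given by its start vertex and the list of the vertices that follow it; edges are labelled by the
-- pair (smaller end, larger end).

Label : Set
Label = ℕ × ℕ

edge : ℕ → ℕ → Label
edge a b = a ⊓ b , a ⊔ b

edge-comm : ∀ a b → edge a b ≡ edge b a
edge-comm a b = cong₂ _,_ (⊓-comm a b) (⊔-comm a b)

edge-≤ : ∀ {a b} → a ≤ b → edge a b ≡ (a , b)
edge-≤ a≤b = cong₂ _,_ (m≤n⇒m⊓n≡m a≤b) (m≤n⇒m⊔n≡n a≤b)

edge-≥ : ∀ {a b} → b ≤ a → edge a b ≡ (b , a)
edge-≥ {a} {b} b≤a = trans (edge-comm a b) (edge-≤ b≤a)

labels : ℕ → List ℕ → List Label
labels u []       = []
labels u (x ∷ xs) = edge u x ∷ labels x xs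

end : ℕ → List ℕ → ℕ
end u []       = u
end u (x ∷ xs) = end x xs

end-++ : ∀ u xs ys → end u (xs ++ ys) ≡ end (end u xs) ys
end-++ u []       ys = refl
end-++ u (x ∷ xs) ys = end-++ x xs ys

labels-++ : ∀ u xs ys → labels u (xs ++ ys) ≡ labels u xs ++ labels (end u xs) ys
labels-++ u []       ys = refl
labels-++ u (x ∷ xs) ys = cong (edge u x ∷_) (labels-++ x xs ys)

-- The reversed walk. It starts at `end u xs`, which the list omits since start vertices are not
-- listed.
back : ℕ → List ℕ → List ℕ
back u []       = []
back u (x ∷ xs) = back x xs ++ [ u ]

length-back : ∀ u xs → length (back u xs) ≡ length xs
length-back u []       = refl
length-back u (x ∷ xs) = trans (length-++ (back x xs)) (trans (+-comm _ 1) (cong suc (length-back x xs)))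

end-back : ∀ u xs → end (end u xs) (back u xs) ≡ u
end-back u []       = refl
end-back u (x ∷ xs) = end-++ (end x xs) (back x xs) [ u ]

labels-back : ∀ u xs → labels (end u xs) (back u xs) ↭ labels u xs
labels-back u []       = ↭-refl
labels-back u (x ∷ xs) = begin
  labels e (back x xs ++ [ u ])                       ≡⟨ labels-++ e (back x xs) [ u ] ⟩
  labels e (back x xs) ++ [ edge (end e (back x xs)) u ] ≡⟨ cong (λ v → labels e (back x xs) ++ [ edge v u ]) (end-back x xs) ⟩
  labels e (back x xs) ++ [ edge x u ]                ↭⟨ Perm.++-comm (labels e (back x xs)) [ edge x u ] ⟩
  edge x u ∷ labels e (back x xs)                     ≡⟨ cong (_∷ labels e (back x xs)) (edge-comm x u) ⟩
  edge u x ∷ labels e (back x xs)                     ↭⟨ Perm.prep (edge u x) (labels-back x xs) ⟩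
  edge u x ∷ labels x xs                              ∎
  where
  open Perm.PermutationReasoning
  e = end x xs

-- A closed trail at 0 split into A and B yields the two walks A and reverse B, both from 0 to the split vertex.
module _ (A B : List ℕ) (closed : end 0 (A ++ B) ≡ 0) where
  private
    m = end 0 A
    closed′ : end m B ≡ 0
    closed′ = trans (sym (end-++ 0 A B)) closed

  end-return : end 0 (back m B) ≡ m
  end-return = trans (cong (λ v → end v (back m B)) (sym closed′)) (end-back m B)

  labels-return : labels 0 (back m B) ↭ labels m B
  labels-return = ↭-trans (↭-reflexive (cong (λ v → labels v (back m B)) (sym closed′))) (labels-back m B)

  labels-fork : labels 0 A ++ labels 0 (back m B) ↭ labels 0 (A ++ B)
  labels-fork = ↭-trans (Perm.++⁺ˡ (labels 0 A) labels-return) (↭-reflexive (sym (labels-++ 0 A B)))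

  -- The extra step to `x` will be the matching edge at the split vertex `m`, for an even number of
  -- colours.
  labels-forkˡ : ∀ x → labels 0 (A ++ [ x ]) ++ labels 0 (back m B) ↭ edge m x ∷ labels 0 (A ++ B)
  labels-forkˡ x = begin
    labels 0 (A ++ [ x ]) ++ labels 0 (back m B)          ≡⟨ cong (_++ labels 0 (back m B)) (labels-++ 0 A [ x ]) ⟩
    (labels 0 A ++ [ edge m x ]) ++ labels 0 (back m B)   ≡⟨ ++-assoc (labels 0 A) _ _ ⟩
    labels 0 A ++ edge m x ∷ labels 0 (back m B)          ↭⟨ Perm.shift (edge m x) (labels 0 A) _ ⟩
    edge m x ∷ labels 0 A ++ labels 0 (back m B)          ↭⟨ Perm.prep _ labels-fork ⟩
    edge m x ∷ labels 0 (A ++ B)                          ∎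
    where open Perm.PermutationReasoning

  labels-forkʳ : ∀ x → labels 0 A ++ labels 0 (back m B ++ [ x ]) ↭ edge m x ∷ labels 0 (A ++ B)
  labels-forkʳ x = begin
    labels 0 A ++ labels 0 (back m B ++ [ x ])            ≡⟨ cong (labels 0 A ++_) (labels-++ 0 (back m B) [ x ]) ⟩
    labels 0 A ++ (labels 0 (back m B) ++ [ edge (end 0 (back m B)) x ])
      ≡⟨ cong (λ v → labels 0 A ++ (labels 0 (back m B) ++ [ edge v x ])) end-return ⟩
    labels 0 A ++ (labels 0 (back m B) ++ [ edge m x ])   ≡⟨ ++-assoc (labels 0 A) _ _ ⟨
    (labels 0 A ++ labels 0 (back m B)) ++ [ edge m x ]   ↭⟨ Perm.++-comm _ [ edge m x ] ⟩
    edge m x ∷ labels 0 A ++ labels 0 (back m B)          ↭⟨ Perm.prep _ labels-fork ⟩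
    edge m x ∷ labels 0 (A ++ B)                          ∎
    where open Perm.PermutationReasoning

-- From four walks to a colouring of the spider

vertex : ℕ → List ℕ → ℕ → ℕ
vertex u w        zero    = u
vertex u []       (suc n) = u
vertex u (x ∷ xs) (suc n) = vertex x xs n

stepLabel : ℕ → List ℕ → ℕ → Label
stepLabel u w n = edge (vertex u w n) (vertex u w (suc n))

stepLabel∈labels : ∀ u w {n} → n < length w → stepLabel u w n ∈ labels u w
stepLabel∈labels u (x ∷ xs) {zero}  _         = here refl
stepLabel∈labels u (x ∷ xs) {suc n} (s≤s n<l) = there (stepLabel∈labels x xs n<l)

stepLabel-injective : ∀ u w → Unique (labels u w) → ∀ {m n} → m < length w → n < length w →
  stepLabel u w m ≡ stepLabel u w n → m ≡ n
stepLabel-injective u (x ∷ xs) (a ∷ _)  {zero}  {zero}  _ _ _ = refl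
stepLabel-injective u (x ∷ xs) (a ∷ _)  {zero}  {suc n} _ (s≤s n<l) eq =
  ⊥-elim (All.lookup a (stepLabel∈labels x xs n<l) eq)
stepLabel-injective u (x ∷ xs) (a ∷ _)  {suc m} {zero}  (s≤s m<l) _ eq =
  ⊥-elim (All.lookup a (stepLabel∈labels x xs m<l) (sym eq))
stepLabel-injective u (x ∷ xs) (_ ∷ un) {suc m} {suc n} (s≤s m<l) (s≤s n<l) eq =
  cong suc (stepLabel-injective x xs un m<l n<l eq)

maybe-prevIdx : ∀ {n} (f : ℕ → ℕ) (j : Fin n) → maybe (f ∘ suc ∘ toℕ) (f 0) (prevIdx j) ≡ f (toℕ j)
maybe-prevIdx f Fin.zero    = refl
maybe-prevIdx f (Fin.suc j) = cong (f ∘ suc) (toℕ-inject₁ j)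

-- Each leg is coloured by an initial segment of its walk, so walks may be longer than the legs.
module _ {k} (0<k : 0 < k) (l₁ l₂ l₃ l₄ : ℕ) (w : Fin 4 → List ℕ)
         (long : ∀ i → legs l₁ l₂ l₃ l₄ i ≤ length (w i))
         (unique : Unique (concat (tabulate (labels 0 ∘ w))))
         (bounded : All (λ l → proj₂ l < k) (concat (tabulate (labels 0 ∘ w))))
         where
  private
    G = Spider l₁ l₂ l₃ l₄

    index< : ∀ i (j : Fin (legs l₁ l₂ l₃ l₄ i)) → toℕ j < length (w i)
    index< i j = <-≤-trans (toℕ<n j) (long i)

    step∈ : ∀ i j → stepLabel 0 (w i) (toℕ j) ∈ labels 0 (w i)
    step∈ i j = stepLabel∈labels 0 (w i) (index< i j)

    vertex<k : ∀ i (j : Fin (legs l₁ l₂ l₃ l₄ i)) → vertex 0 (w i) (suc (toℕ j)) < k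
    vertex<k i j = ≤-<-trans (m≤n⊔m (vertex 0 (w i) (toℕ j)) _)
      (All.lookup bounded (∈-concat-tabulate 4 (labels 0 ∘ w) i (step∈ i j)))

    colour : V G → Fin k
    colour nothing        = fromℕ< 0<k
    colour (just (i , j)) = fromℕ< (vertex<k i j)

    toℕ-colour : ∀ i m → toℕ (colour (Maybe.map (i ,_) m)) ≡ maybe (vertex 0 (w i) ∘ suc ∘ toℕ) 0 m
    toℕ-colour i nothing  = toℕ-fromℕ< 0<k
    toℕ-colour i (just j) = toℕ-fromℕ< (vertex<k i j)

    label : E G → Label
    label e = edge (toℕ (colour (end₁ G e))) (toℕ (colour (end₂ G e)))

    label≡step : ∀ i j → label (i , j) ≡ stepLabel 0 (w i) (toℕ j)
    label≡step i j = cong₂ edge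
      (trans (toℕ-colour i (prevIdx j)) (maybe-prevIdx (vertex 0 (w i)) j))
      (toℕ-fromℕ< (vertex<k i j))

    label-cong : ∀ e f → SameLabel (colour (end₁ G e)) (colour (end₂ G e)) (colour (end₁ G f)) (colour (end₂ G f)) →
      label e ≡ label f
    label-cong e f (inj₁ (p , q)) = cong₂ (λ a b → edge (toℕ a) (toℕ b)) p q
    label-cong e f (inj₂ (p , q)) =
      trans (cong₂ (λ a b → edge (toℕ a) (toℕ b)) p q) (edge-comm (toℕ (colour (end₂ G f))) _)

    -- Uniqueness of the concatenated labels first puts equal labels in the same walk, then at the
    -- same position of it.
    label-injective : ∀ e f → label e ≡ label f → e ≡ f
    label-injective (i , j) (i′ , j′) eq
      with Unique-concat-tabulate⇒≡ 4 (labels 0 ∘ w) unique i i′ (step∈ i j)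
             (subst (_∈ labels 0 (w i′)) (trans (sym (label≡step i′ j′)) (trans (sym eq) (label≡step i j))) (step∈ i′ j′))
    ... | refl = cong (i ,_) (toℕ-injective (stepLabel-injective 0 (w i)
           (Unique-concat-tabulate⁻ 4 (labels 0 ∘ w) unique i) (index< i j) (index< i j′)
           (trans (sym (label≡step i j)) (trans eq (label≡step i j′)))))

  colourable : EDColorable G k
  colourable = colour , λ e f same → label-injective e f (label-cong e f same)

-- Pairs of closed trails

-- A zigzag from `j * 2` to 0 between the old vertices and the new `y`, `z`. It takes the edges from
-- `y` to 1, ..., 2j and from `z` to 0, ..., 2j-1. The edges {0, y} and {2j, z} remain for closing
-- it up at 0.
down : ℕ → ℕ → ℕ → List ℕ
down y z zero    = []
down y z (suc j) = y ∷ suc (j * 2) ∷ z ∷ j * 2 ∷ down y z j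

end-down : ∀ y z j → end (j * 2) (down y z j) ≡ 0
end-down y z zero    = refl
end-down y z (suc j) = end-down y z j

length-down : ∀ y z j → length (down y z j) ≡ j * 4
length-down y z zero    = refl
length-down y z (suc j) = cong (4 +_) (length-down y z j)

proj₁-≢ : ∀ {l m : Label} → proj₁ l ≢ proj₁ m → l ≢ m
proj₁-≢ ne eq = ne (cong proj₁ eq)

proj₂-≢ : ∀ {l m : Label} → proj₂ l ≢ proj₂ m → l ≢ m
proj₂-≢ ne eq = ne (cong proj₂ eq)

module Zigzag (y z : ℕ) (y<z : y < z) where

  labels-down : ∀ j → suc (j * 2) < y → labels (suc j * 2) (down y z (suc j)) ≡
    (suc j * 2 , y) ∷ (suc (j * 2) , y) ∷ (suc (j * 2) , z) ∷ (j * 2 , z) ∷ labels (j * 2) (down y z j)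
  labels-down j b =
    cong₂ _∷_ (edge-≤ b) (cong₂ _∷_ (edge-≥ b′) (cong₂ _∷_ (edge-≤ (<⇒≤ (≤-<-trans b′ y<z)))
      (cong₂ _∷_ (edge-≥ (≤-trans (n≤1+n _) (<⇒≤ (≤-<-trans b′ y<z)))) refl)))
    where b′ = <⇒≤ b

  -- The invariant behind distinctness: the only label with smaller end `n` is `(n , y)`, so
  -- `(n , z)` is still available for the step that enters the zigzag, and `(0 , y)` for the first
  -- step of the loop.
  Down : ℕ → Label → Set
  Down n l = (proj₁ l < n ⊎ l ≡ (n , y)) × l ≢ (0 , y) × (proj₂ l ≡ y ⊎ proj₂ l ≡ z)

  Down⇒≤ : ∀ {n l} → Down n l → proj₁ l ≤ n
  Down⇒≤ (inj₁ p<    , _) = <⇒≤ p<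
  Down⇒≤ (inj₂ refl , _) = ≤-refl

  All-Down : ∀ j → j * 2 < y → All (Down (j * 2)) (labels (j * 2) (down y z j))
  All-Down zero    b = []
  All-Down (suc j) b = subst (All (Down (suc j * 2))) (sym (labels-down j (<⇒≤ b)))
    ( (inj₂ refl , proj₁-≢ (λ ()) , inj₁ refl)
    ∷ (inj₁ ≤-refl , proj₁-≢ (λ ()) , inj₁ refl)
    ∷ (inj₁ ≤-refl , proj₁-≢ (λ ()) , inj₂ refl)
    ∷ (inj₁ (n≤1+n _) , proj₂-≢ (>⇒≢ y<z) , inj₂ refl)
    ∷ All.map (λ d → inj₁ (s≤s (≤-trans (Down⇒≤ d) (n≤1+n _))) , proj₂ d) (All-Down j (<⇒≤ (<⇒≤ b))))

  module _ {n : ℕ} {ls : List Label} (ds : All (Down n) ls) where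

    above-fresh : ∀ {l} → n < proj₁ l → All (l ≢_) ls
    above-fresh p = All.map (λ d → proj₁-≢ (>⇒≢ (≤-<-trans (Down⇒≤ d) p))) ds

    last-fresh : All ((n , z) ≢_) ls
    last-fresh = All.map (λ { (inj₁ p , _) → proj₁-≢ (>⇒≢ p) ; (inj₂ refl , _) → proj₂-≢ (>⇒≢ y<z) }) ds

    first-fresh : All ((0 , y) ≢_) ls
    first-fresh = All.map (λ d eq → proj₁ (proj₂ d) (sym eq)) ds

  Unique-down : ∀ j → j * 2 < y → Unique (labels (j * 2) (down y z j))
  Unique-down zero    b = []
  Unique-down (suc j) b = subst Unique (sym (labels-down j (<⇒≤ b)))
    ( (proj₁-≢ 1+n≢n ∷ proj₁-≢ 1+n≢n ∷ proj₁-≢ (>⇒≢ (n≤1+n _)) ∷ above-fresh ds (n≤1+n _))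
    ∷ (proj₂-≢ (<⇒≢ y<z) ∷ proj₁-≢ 1+n≢n ∷ above-fresh ds ≤-refl)
    ∷ (proj₁-≢ 1+n≢n ∷ above-fresh ds ≤-refl)
    ∷ last-fresh ds
    ∷ Unique-down j (<⇒≤ (<⇒≤ b)))
    where ds = All-Down j (<⇒≤ (<⇒≤ b))

  -- With `y` = 2j+1 and `z` = 2j+2 this closed trail takes every edge at the two new vertices,
  -- including both loops and {y, z}.
  oddLoop : ℕ → List ℕ
  oddLoop j = y ∷ y ∷ z ∷ z ∷ j * 2 ∷ down y z j

  -- With `y` = 2j+2 and `z` = 2j+3 the detour through 2j+1 replaces the edge {y, z}, which is the
  -- new matching edge; every other edge at `y` and `z` is taken.
  evenLoop : ℕ → List ℕ
  evenLoop j = y ∷ y ∷ suc (j * 2) ∷ z ∷ z ∷ j * 2 ∷ down y z j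

  labels-oddLoop : ∀ j → j * 2 < y →
    labels 0 (oddLoop j) ≡ (0 , y) ∷ (y , y) ∷ (y , z) ∷ (z , z) ∷ (j * 2 , z) ∷ labels (j * 2) (down y z j)
  labels-oddLoop j b =
    cong₂ _∷_ (edge-≤ {0} z≤n) (cong₂ _∷_ (edge-≤ ≤-refl) (cong₂ _∷_ (edge-≤ (<⇒≤ y<z))
    (cong₂ _∷_ (edge-≤ ≤-refl) (cong₂ _∷_ (edge-≥ (<⇒≤ (<-trans b y<z))) refl))))

  labels-evenLoop : ∀ j → suc (j * 2) < y →
    labels 0 (evenLoop j) ≡ (0 , y) ∷ (y , y) ∷ (suc (j * 2) , y) ∷ (suc (j * 2) , z) ∷ (z , z) ∷ (j * 2 , z)
                          ∷ labels (j * 2) (down y z j)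
  labels-evenLoop j b =
    cong₂ _∷_ (edge-≤ {0} z≤n) (cong₂ _∷_ (edge-≤ ≤-refl) (cong₂ _∷_ (edge-≥ (<⇒≤ b))
    (cong₂ _∷_ (edge-≤ (<⇒≤ (<-trans b y<z))) (cong₂ _∷_ (edge-≤ ≤-refl)
    (cong₂ _∷_ (edge-≥ (<⇒≤ (<-trans (<⇒≤ b) y<z))) refl)))))

  Unique-oddLoop : ∀ j → j * 2 < y → Unique (labels 0 (oddLoop j))
  Unique-oddLoop j b = subst Unique (sym (labels-oddLoop j b))
    ( (proj₁-≢ (<⇒≢ 0<y) ∷ proj₂-≢ y≢z ∷ proj₂-≢ y≢z ∷ proj₂-≢ y≢z ∷ first-fresh ds)
    ∷ (proj₂-≢ y≢z ∷ proj₂-≢ y≢z ∷ proj₂-≢ y≢z ∷ above-fresh ds b)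
    ∷ (proj₁-≢ y≢z ∷ proj₁-≢ (>⇒≢ b) ∷ above-fresh ds b)
    ∷ (proj₁-≢ (>⇒≢ (<-trans b y<z)) ∷ above-fresh ds (<-trans b y<z))
    ∷ last-fresh ds
    ∷ Unique-down j b)
    where
    ds  = All-Down j b
    y≢z = <⇒≢ y<z
    0<y = ≤-<-trans z≤n b

  Unique-evenLoop : ∀ j → suc (j * 2) < y → Unique (labels 0 (evenLoop j))
  Unique-evenLoop j b = subst Unique (sym (labels-evenLoop j b))
    ( (proj₁-≢ (<⇒≢ 0<y) ∷ proj₁-≢ (λ ()) ∷ proj₁-≢ (λ ()) ∷ proj₂-≢ y≢z ∷ proj₂-≢ y≢z ∷ first-fresh ds)
    ∷ (proj₁-≢ (>⇒≢ b) ∷ proj₂-≢ y≢z ∷ proj₂-≢ y≢z ∷ proj₂-≢ y≢z ∷ above-fresh ds b′)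
    ∷ (proj₂-≢ y≢z ∷ proj₂-≢ y≢z ∷ proj₂-≢ y≢z ∷ above-fresh ds ≤-refl)
    ∷ (proj₁-≢ (<⇒≢ (<-trans b y<z)) ∷ proj₁-≢ 1+n≢n ∷ above-fresh ds ≤-refl)
    ∷ (proj₁-≢ (>⇒≢ (<-trans b′ y<z)) ∷ above-fresh ds (<-trans b′ y<z))
    ∷ last-fresh ds
    ∷ Unique-down j b′)
    where
    b′  = <⇒≤ b
    ds  = All-Down j b′
    y≢z = <⇒≢ y<z
    0<y = ≤-<-trans z≤n b

  All-oddLoop : ∀ j → j * 2 < y → All (λ l → proj₂ l ≡ y ⊎ proj₂ l ≡ z) (labels 0 (oddLoop j))
  All-oddLoop j b = subst (All _) (sym (labels-oddLoop j b))
    (inj₁ refl ∷ inj₁ refl ∷ inj₂ refl ∷ inj₂ refl ∷ inj₂ refl ∷ All.map (proj₂ ∘ proj₂) (All-Down j b))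

  -- The first component excludes {y, z}: a label is a loop or has an old vertex as its smaller end.
  All-evenLoop : ∀ j → suc (j * 2) < y →
    All (λ l → (proj₁ l ≡ proj₂ l ⊎ proj₁ l < y) × (proj₂ l ≡ y ⊎ proj₂ l ≡ z)) (labels 0 (evenLoop j))
  All-evenLoop j b = subst (All _) (sym (labels-evenLoop j b))
    ( (inj₂ (≤-<-trans z≤n b) , inj₁ refl)
    ∷ (inj₁ refl , inj₁ refl)
    ∷ (inj₂ b , inj₁ refl)
    ∷ (inj₂ b , inj₂ refl)
    ∷ (inj₁ refl , inj₂ refl)
    ∷ (inj₂ b′ , inj₂ refl)
    ∷ All.map (λ d → inj₂ (≤-<-trans (Down⇒≤ d) b′) , proj₂ (proj₂ d)) (All-Down j b′))
    where b′ = <⇒≤ b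

record TrailPair (P : Label → Set) (C D : List ℕ) : Set where
  field
    closedˡ : end 0 C ≡ 0
    closedʳ : end 0 D ≡ 0
    unique  : Unique (labels 0 C ++ labels 0 D)
    all     : All P (labels 0 C ++ labels 0 D)

swapTrails : ∀ {P C D} → TrailPair P C D → TrailPair P D C
swapTrails {C = C} {D} t = record
  { closedˡ = closedʳ
  ; closedʳ = closedˡ
  ; unique  = Unique-resp-↭ (Perm.++-comm (labels 0 C) (labels 0 D)) unique
  ; all     = Perm.All-resp-↭ (Perm.++-comm (labels 0 C) (labels 0 D)) all
  }
  where open TrailPair t

labels-closed-++ : ∀ D N → end 0 D ≡ 0 → labels 0 (D ++ N) ≡ labels 0 D ++ labels 0 N
labels-closed-++ D N closed = trans (labels-++ 0 D N) (cong (λ u → labels 0 D ++ labels u N) closed)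

-- Both trails pass through 0, so the new closed trail `N` can be traversed right after `D`.
splice : ∀ {P Q C D} N → TrailPair P C D → end 0 N ≡ 0 → Unique (labels 0 N) → All Q (labels 0 N) →
  (∀ {l} → P l → Q l) → (∀ {l} → P l → l ∉ labels 0 N) → TrailPair Q C (D ++ N)
splice {P} {Q} {C} {D} N t closed un al P⇒Q fresh = record
  { closedˡ = closedˡ
  ; closedʳ = trans (end-++ 0 D N) (trans (cong (λ u → end u N) closedʳ) closed)
  ; unique  = subst Unique (sym reassoc) (Unique.++⁺ unique un (λ (p , q) → fresh (All.lookup all p) q))
  ; all     = subst (All Q) (sym reassoc) (All.++⁺ (All.map P⇒Q all) al)
  }
  where
  open TrailPair t
  reassoc : labels 0 C ++ labels 0 (D ++ N) ≡ (labels 0 C ++ labels 0 D) ++ labels 0 N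
  reassoc = trans (cong (labels 0 C ++_) (labels-closed-++ D N closedʳ)) (sym (++-assoc (labels 0 C) _ _))

-- Odd number of colours

open Zigzag

split : ∀ a c (C : List ℕ) → a + c ≤ length C → ∃₂ λ A B → C ≡ A ++ B × length A ≡ a × c ≤ length B
split a c C a+c≤ = take a C , drop a C , sym (take++drop≡id a C)
  , trans (length-take a C) (m≤n⇒m⊓n≡m (m+n≤o⇒m≤o a a+c≤))
  , subst (c ≤_) (sym (length-drop a C)) (m+n≤o⇒m≤o∸n c (subst (_≤ length C) (+-comm a c) a+c≤))

module _ {k} (0<k : 0 < k) {l₁ l₂ l₃ l₄} (w₁ w₂ w₃ w₄ : List ℕ)
         (b₁ : l₁ ≤ length w₁) (b₂ : l₂ ≤ length w₂) (b₃ : l₃ ≤ length w₃) (b₄ : l₄ ≤ length w₄)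
         {L : List Label} (perm : labels 0 w₁ ++ labels 0 w₂ ++ labels 0 w₃ ++ labels 0 w₄ ↭ L)
         (un : Unique L) (al : All (λ l → proj₂ l < k) L) where
  private
    w : Fin 4 → List ℕ
    w 0F = w₁
    w 1F = w₂
    w 2F = w₃
    w 3F = w₄

    long : ∀ i → legs l₁ l₂ l₃ l₄ i ≤ length (w i)
    long 0F = b₁
    long 1F = b₂
    long 2F = b₃
    long 3F = b₄

    perm′ : L ↭ concat (tabulate (labels 0 ∘ w))
    perm′ = ↭-sym (↭-trans (↭-reflexive
      (cong (λ v → labels 0 w₁ ++ labels 0 w₂ ++ labels 0 w₃ ++ v) (++-identityʳ (labels 0 w₄)))) perm)

  colourByLegs : EDColorable (Spider l₁ l₂ l₃ l₄) k
  colourByLegs = colourable 0<k l₁ l₂ l₃ l₄ w long (Unique-resp-↭ perm′ un) (Perm.All-resp-↭ perm′ al)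

module _ {A : Set} (xs ys zs ws : List A) where

  -- The middle two legs come from one closed trail and the outer two from the other.
  outer-inner : xs ++ ys ++ zs ++ ws ↭ (ys ++ zs) ++ (xs ++ ws)
  outer-inner = begin
    xs ++ ys ++ zs ++ ws     ≡⟨ cong (xs ++_) (++-assoc ys zs ws) ⟨
    xs ++ (ys ++ zs) ++ ws   ↭⟨ Perm.shifts xs (ys ++ zs) ⟩
    (ys ++ zs) ++ xs ++ ws   ∎
    where open Perm.PermutationReasoning

OddLabel : ℕ → Label → Set
OddLabel k l = proj₂ l < k

fromOddTrails : ∀ {k C D l₁ l₂ l₃ l₄} → 0 < k → TrailPair (OddLabel k) C D →
  l₂ + l₃ ≤ length C → l₁ + l₄ ≤ length D → EDColorable (Spider l₁ l₂ l₃ l₄) k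
fromOddTrails {k} {C} {D} {l₁} {l₂} {l₃} {l₄} 0<k t ≤C ≤D
  with A  , B  , refl , refl , ≤B  ← split l₂ l₃ C ≤C
     | A′ , B′ , refl , refl , ≤B′ ← split l₁ l₄ D ≤D
  = colourByLegs 0<k A′ A (back (end 0 A) B) (back (end 0 A′) B′)
      ≤-refl ≤-refl (subst (l₃ ≤_) (sym (length-back _ B)) ≤B) (subst (l₄ ≤_) (sym (length-back _ B′)) ≤B′)
      (↭-trans (outer-inner (labels 0 A′) (labels 0 A) _ _)
               (Perm.++⁺ (labels-fork A B closedˡ) (labels-fork A′ B′ closedʳ)))
      unique all
  where open TrailPair t

_≟ₗ_ : (l m : Label) → Dec (l ≡ m)
_≟ₗ_ = ≡-dec _≟_ _≟_

module _ {T N : ℕ} {Old New : ℕ → ℕ → Set}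
         (old : ∀ p q → 3 ≤ p → 3 ≤ q → p + q ≡ T → Old p q)
         (growʳ : ∀ {p q} → Old p q → New p (q + N))
         (growˡ : ∀ {p q} → Old p q → New (p + N) q)
         (exceptional : ∀ p q → p ≤ 2 + N → q ≤ 2 + N → p + q ≡ T + N → New p q) where

  -- A length of at least `3 + N` can lose `N` and still be at least 3, so the induction hypothesis
  -- fails to apply only if both lengths are at most `2 + N`.
  grow : ∀ p q → 3 ≤ p → 3 ≤ q → p + q ≡ T + N → New p q
  grow p q 3≤p 3≤q eq with 3 + N ≤? q | 3 + N ≤? p
  ... | yes b | _ = subst (New p) q′+N≡q (growʳ (old p (q ∸ N) 3≤p (m+n≤o⇒m≤o∸n 3 b)
                      (+-cancelʳ-≡ N _ _ (trans (+-assoc p _ N) (trans (cong (p +_) q′+N≡q) eq)))))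
    where q′+N≡q = m∸n+n≡m (m+n≤o⇒n≤o 3 b)
  ... | no _ | yes b = subst (λ r → New r q) p′+N≡p (growˡ (old (p ∸ N) q (m+n≤o⇒m≤o∸n 3 b) 3≤q
                      (+-cancelʳ-≡ N _ _ (trans (swap (p ∸ N) q N) (trans (cong (_+ q) p′+N≡p) eq)))))
    where
    p′+N≡p = m∸n+n≡m (m+n≤o⇒n≤o 3 b)
    swap : ∀ a b c → a + b + c ≡ a + c + b
    swap = solve-∀
  ... | no c | no d = exceptional p q (≤-pred (≰⇒> d)) (≤-pred (≰⇒> c)) eq

OddTrails : ℕ → ℕ → ℕ → Set
OddTrails j p q = ∃₂ λ C D → length C ≡ p × length D ≡ q × TrailPair (OddLabel (suc (j * 2))) C D

swapOdd : ∀ j {p q} → OddTrails j p q → OddTrails j q p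
swapOdd j (C , D , eqC , eqD , t) = D , C , eqD , eqC , swapTrails t

oddTrails! : ∀ j C D {_ : True (end 0 C ≟ 0)} {_ : True (end 0 D ≟ 0)}
  {_ : True (unique? _≟ₗ_ (labels 0 C ++ labels 0 D))}
  {_ : True (All.all? (λ l → proj₂ l <? suc (j * 2)) (labels 0 C ++ labels 0 D))} → OddTrails j (length C) (length D)
oddTrails! j C D {a} {b} {c} {d} = C , D , refl , refl , record
  { closedˡ = toWitness a ; closedʳ = toWitness b ; unique = toWitness c ; all = toWitness d }

-- The trails of the base cases, here and below, were found by a backtracking search.
oddTrails₅≤7 : ∀ p q → 3 ≤ p → p ≤ 7 → p + q ≡ 15 → OddTrails 2 p q
oddTrails₅≤7 1 q (s≤s ()) p≤7 eq
oddTrails₅≤7 2 q (s≤s (s≤s ())) p≤7 eq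
oddTrails₅≤7 3 q _ _ refl = oddTrails! 2 (1 ∷ 2 ∷ 0 ∷ []) (0 ∷ 3 ∷ 1 ∷ 1 ∷ 4 ∷ 2 ∷ 2 ∷ 3 ∷ 3 ∷ 4 ∷ 4 ∷ 0 ∷ [])
oddTrails₅≤7 4 q _ _ refl = oddTrails! 2 (0 ∷ 1 ∷ 2 ∷ 0 ∷ []) (3 ∷ 1 ∷ 1 ∷ 4 ∷ 2 ∷ 2 ∷ 3 ∷ 3 ∷ 4 ∷ 4 ∷ 0 ∷ [])
oddTrails₅≤7 5 q _ _ refl = oddTrails! 2 (0 ∷ 1 ∷ 1 ∷ 2 ∷ 0 ∷ []) (3 ∷ 1 ∷ 4 ∷ 2 ∷ 2 ∷ 3 ∷ 3 ∷ 4 ∷ 4 ∷ 0 ∷ [])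
oddTrails₅≤7 6 q _ _ refl = oddTrails! 2 (0 ∷ 1 ∷ 1 ∷ 2 ∷ 2 ∷ 0 ∷ []) (3 ∷ 1 ∷ 4 ∷ 2 ∷ 3 ∷ 3 ∷ 4 ∷ 4 ∷ 0 ∷ [])
oddTrails₅≤7 7 q _ _ refl = oddTrails! 2 (0 ∷ 1 ∷ 1 ∷ 2 ∷ 2 ∷ 3 ∷ 0 ∷ []) (2 ∷ 4 ∷ 1 ∷ 3 ∷ 3 ∷ 4 ∷ 4 ∷ 0 ∷ [])
oddTrails₅≤7 (suc (suc (suc (suc (suc (suc (suc (suc p)))))))) q _ p≤7 eq = ⊥-elim (m+n≮m 7 p p≤7)

oddTrails₅ : ∀ p q → 3 ≤ p → 3 ≤ q → p + q ≡ 15 → OddTrails 2 p q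
oddTrails₅ p q 3≤p 3≤q eq with p ≤? 7
... | yes p≤7 = oddTrails₅≤7 p q 3≤p p≤7 eq
... | no  p≰7 = swapOdd 2 (oddTrails₅≤7 q p 3≤q q≤7 (trans (+-comm q p) eq))
  where
  q≤7 : q ≤ 7
  q≤7 = +-cancelˡ-≤ 8 q 7 (≤-trans (+-monoˡ-≤ q (≰⇒> p≰7)) (≤-reflexive eq))

oddTrails₇-13-15 : OddTrails 3 13 15
oddTrails₇-13-15 = oddTrails! 3 (0 ∷ 1 ∷ 1 ∷ 2 ∷ 0 ∷ 3 ∷ 1 ∷ 4 ∷ 2 ∷ 2 ∷ 3 ∷ 4 ∷ 0 ∷ [])
  (5 ∷ 1 ∷ 6 ∷ 2 ∷ 5 ∷ 3 ∷ 3 ∷ 6 ∷ 4 ∷ 4 ∷ 5 ∷ 5 ∷ 6 ∷ 6 ∷ 0 ∷ [])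

oddTrails₇-14-14 : OddTrails 3 14 14
oddTrails₇-14-14 = oddTrails! 3 (0 ∷ 1 ∷ 1 ∷ 2 ∷ 0 ∷ 3 ∷ 1 ∷ 4 ∷ 2 ∷ 2 ∷ 3 ∷ 3 ∷ 4 ∷ 0 ∷ [])
  (5 ∷ 1 ∷ 6 ∷ 2 ∷ 5 ∷ 3 ∷ 6 ∷ 4 ∷ 4 ∷ 5 ∷ 5 ∷ 6 ∷ 6 ∷ 0 ∷ [])

-- The case that `grow` leaves open between five and seven colours: 13 new edges, so both lengths
-- are at most 15, and 28 edges in all.
oddTrails₇-middle : ∀ p q → p ≤ 15 → q ≤ 15 → p + q ≡ 28 → OddTrails 3 p q
oddTrails₇-middle p q p≤15 q≤15 eq = subst (OddTrails 3 p) q≡ (lemma (q ∸ 13)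
    (+-cancelˡ-≤ 13 _ 2 (subst (_≤ 15) (sym q≡) q≤15)) (trans (cong (_+ p) q≡) (trans (+-comm q p) eq)))
  where
  q≡ : 13 + (q ∸ 13) ≡ q
  q≡ = m+[n∸m]≡n (+-cancelˡ-≤ 15 13 q (≤-trans (≤-reflexive (sym eq)) (+-monoˡ-≤ q p≤15)))
  lemma : ∀ o {p} → o ≤ 2 → 13 + o + p ≡ 28 → OddTrails 3 p (13 + o)
  lemma 0 _ refl = swapOdd 3 oddTrails₇-13-15
  lemma 1 _ refl = oddTrails₇-14-14
  lemma 2 _ refl = oddTrails₇-13-15
  lemma (suc (suc (suc o))) (s≤s (s≤s ())) eq

growOdd : ∀ j {p q} → OddTrails j p q → OddTrails (suc j) p (q + (5 + j * 4))
growOdd j (C , D , eqC , eqD , t) = C , D ++ N , eqC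
  , trans (length-++ D) (cong₂ _+_ eqD (cong (5 +_) (length-down y z j)))
  , splice N t (end-down y z j) (Unique-oddLoop y z ≤-refl j ≤-refl)
      (All.map [ (λ { refl → n≤1+n _ }) , (λ { refl → ≤-refl }) ]′ new)
      (λ l< → ≤-trans l< (≤-trans (n≤1+n _) (n≤1+n _)))
      (λ l< l∈ → fresh l< (All.lookup new l∈))
  where
  y = suc (j * 2)
  z = suc y
  N = oddLoop y z ≤-refl j
  new = All-oddLoop y z ≤-refl j ≤-refl
  fresh : ∀ {n} → n < y → ¬ (n ≡ y ⊎ n ≡ z)
  fresh n< (inj₁ refl) = <-irrefl refl n<
  fresh n< (inj₂ refl) = <-asym n< ≤-refl

oddSize-suc : ∀ j → suc (suc j * 2) * suc (suc j) ≡ suc (j * 2) * suc j + (5 + j * 4)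
oddSize-suc = solve-∀

-- The induction starts at five colours: with three, the lengths 3 and 3 would require the only
-- triangle twice.
oddTrails : ∀ i p q → 3 ≤ p → 3 ≤ q → p + q ≡ suc ((2 + i) * 2) * suc (2 + i) → OddTrails (2 + i) p q
oddTrails zero    p q 3≤p 3≤q eq = oddTrails₅ p q 3≤p 3≤q eq
oddTrails (suc i) p q 3≤p 3≤q eq =
  grow (oddTrails i) (growOdd (2 + i)) (swapOdd (3 + i) ∘ growOdd (2 + i) ∘ swapOdd (2 + i)) (exceptional i) p q 3≤p 3≤q
       (trans eq (oddSize-suc (2 + i)))
  where
  exceptional : ∀ i p q → p ≤ 2 + (5 + (2 + i) * 4) → q ≤ 2 + (5 + (2 + i) * 4) →
    p + q ≡ suc ((2 + i) * 2) * suc (2 + i) + (5 + (2 + i) * 4) → OddTrails (3 + i) p q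
  exceptional zero    p q p≤ q≤ eq = oddTrails₇-middle p q p≤ q≤ eq
  -- From nine colours on, two lengths of at most `2 + N` are too small to reach the total.
  exceptional (suc i) p q p≤ q≤ eq = ⊥-elim (<-irrefl refl (begin-strict
    p + q                                                                ≤⟨ +-mono-≤ p≤ q≤ ⟩
    (2 + (5 + (3 + i) * 4)) + (2 + (5 + (3 + i) * 4))                    <⟨ s≤s (m≤m+n _ (6 + i * 11 + i * i * 2)) ⟩
    suc ((2 + (5 + (3 + i) * 4)) + (2 + (5 + (3 + i) * 4)) + (6 + i * 11 + i * i * 2)) ≡⟨ arith i ⟩
    suc ((3 + i) * 2) * suc (3 + i) + (5 + (3 + i) * 4)                  ≡⟨ eq ⟨
    p + q                                                                ∎))
    where
    open ≤-Reasoning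
    arith : ∀ i → suc ((2 + (5 + (3 + i) * 4)) + (2 + (5 + (3 + i) * 4)) + (6 + i * 11 + i * i * 2)) ≡
                  suc ((3 + i) * 2) * suc (3 + i) + (5 + (3 + i) * 4)
    arith = solve-∀

-- Even number of colours

⌊n*2/2⌋≡n : ∀ n → ⌊ n * 2 /2⌋ ≡ n
⌊n*2/2⌋≡n zero    = refl
⌊n*2/2⌋≡n (suc n) = cong suc (⌊n*2/2⌋≡n n)

⌊1+n*2/2⌋≡n : ∀ n → ⌊ suc (n * 2) /2⌋ ≡ n
⌊1+n*2/2⌋≡n zero    = refl
⌊1+n*2/2⌋≡n (suc n) = cong suc (⌊1+n*2/2⌋≡n n)

m<n*2⇒⌊m/2⌋<n : ∀ {m} n → m < n * 2 → ⌊ m /2⌋ < n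
m<n*2⇒⌊m/2⌋<n {zero}        (suc n) _             = s≤s z≤n
m<n*2⇒⌊m/2⌋<n {suc zero}    (suc n) _             = s≤s z≤n
m<n*2⇒⌊m/2⌋<n {suc (suc m)} (suc n) (s≤s (s≤s b)) = s≤s (m<n*2⇒⌊m/2⌋<n n b)

-- For even k the perfect matching {2i, 2i+1} is removed from the complete graph with loops.
mate : ℕ → ℕ
mate 0             = 1
mate 1             = 0
mate (suc (suc n)) = suc (suc (mate n))

⌊mate/2⌋ : ∀ n → ⌊ mate n /2⌋ ≡ ⌊ n /2⌋
⌊mate/2⌋ 0             = refl
⌊mate/2⌋ 1             = refl
⌊mate/2⌋ (suc (suc n)) = cong suc (⌊mate/2⌋ n)

mate≢ : ∀ n → mate n ≢ n
mate≢ (suc (suc n)) eq = mate≢ n (suc-injective (suc-injective eq))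

mate< : ∀ {n} j → n < j * 2 → mate n < j * 2
mate< {zero}        (suc j) _             = s≤s (s≤s z≤n)
mate< {suc zero}    (suc j) _             = s≤s z≤n
mate< {suc (suc n)} (suc j) (s≤s (s≤s b)) = s≤s (s≤s (mate< j b))

edge-sel : ∀ a b → edge a b ≡ (a , b) ⊎ edge a b ≡ (b , a)
edge-sel a b with ≤-total a b
... | inj₁ a≤b = inj₁ (edge-≤ a≤b)
... | inj₂ b≤a = inj₂ (edge-≥ b≤a)

EvenLabel : ℕ → Label → Set
EvenLabel k l = proj₂ l < k × (⌊ proj₁ l /2⌋ ≡ ⌊ proj₂ l /2⌋ → proj₁ l ≡ proj₂ l)

InClass : ℕ → Label → Set
InClass i l = ⌊ proj₁ l /2⌋ ≡ i × ⌊ proj₂ l /2⌋ ≡ i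

-- For lists of labels without matching edges this says that the loops at two matched vertices
-- do not lie one in each list.
Separate : List Label → List Label → Set
Separate ls ms = All (λ l → All (λ m → ⌊ proj₁ l /2⌋ ≡ ⌊ proj₂ l /2⌋ → ¬ InClass ⌊ proj₁ l /2⌋ m) ms) ls

EvenTrails : ℕ → ℕ → ℕ → Set
EvenTrails j p q = ∃₂ λ C D → length C ≡ p × length D ≡ q × TrailPair (EvenLabel (j * 2)) C D × Separate (labels 0 C) (labels 0 D)

Separate-sym : ∀ ls {ms} → Separate ls ms → Separate ms ls
Separate-sym ls sep = All.tabulate λ m∈ → All.tabulate λ l∈ eq (q₁ , q₂) →
  All.lookup (All.lookup sep l∈) m∈ (trans q₁ (sym q₂)) (sym q₁ , sym (trans q₁ eq))

swapEven : ∀ j {p q} → EvenTrails j p q → EvenTrails j q p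
swapEven j (C , D , eqC , eqD , t , sep) = D , C , eqD , eqC , swapTrails t , Separate-sym (labels 0 C) sep

evenLabel? : ∀ k l → Dec (EvenLabel k l)
evenLabel? k l = (proj₂ l <? k) ×-dec ((⌊ proj₁ l /2⌋ ≟ ⌊ proj₂ l /2⌋) →-dec (proj₁ l ≟ proj₂ l))

separate? : ∀ ls ms → Dec (Separate ls ms)
separate? ls ms = All.all? (λ l → All.all? (λ m → (⌊ proj₁ l /2⌋ ≟ ⌊ proj₂ l /2⌋) →-dec
  ¬? ((⌊ proj₁ m /2⌋ ≟ ⌊ proj₁ l /2⌋) ×-dec (⌊ proj₂ m /2⌋ ≟ ⌊ proj₁ l /2⌋))) ms) ls

evenPair! : ∀ j C D {_ : True (end 0 C ≟ 0)} {_ : True (end 0 D ≟ 0)}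
  {_ : True (unique? _≟ₗ_ (labels 0 C ++ labels 0 D))}
  {_ : True (All.all? (evenLabel? (j * 2)) (labels 0 C ++ labels 0 D))} → TrailPair (EvenLabel (j * 2)) C D
evenPair! j C D {a} {b} {c} {d} = record
  { closedˡ = toWitness a ; closedʳ = toWitness b ; unique = toWitness c ; all = toWitness d }

evenTrails! : ∀ j C D {_ : True (end 0 C ≟ 0)} {_ : True (end 0 D ≟ 0)}
  {_ : True (unique? _≟ₗ_ (labels 0 C ++ labels 0 D))}
  {_ : True (All.all? (evenLabel? (j * 2)) (labels 0 C ++ labels 0 D))}
  {_ : True (separate? (labels 0 C) (labels 0 D))} → EvenTrails j (length C) (length D)
evenTrails! j C D {a} {b} {c} {d} {e} = C , D , refl , refl , evenPair! j C D {a} {b} {c} {d} , toWitness e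

evenTrails₆≤9 : ∀ p q → 3 ≤ p → p ≤ 9 → p + q ≡ 18 → EvenTrails 3 p q
evenTrails₆≤9 1 q (s≤s ()) _ eq
evenTrails₆≤9 2 q (s≤s (s≤s ())) _ eq
evenTrails₆≤9 3 q _ _ refl = evenTrails! 3 (2 ∷ 4 ∷ 0 ∷ []) (0 ∷ 3 ∷ 1 ∷ 1 ∷ 2 ∷ 2 ∷ 5 ∷ 1 ∷ 4 ∷ 4 ∷ 3 ∷ 3 ∷ 5 ∷ 5 ∷ 0 ∷ [])
evenTrails₆≤9 4 q _ _ refl = evenTrails! 3 (2 ∷ 1 ∷ 3 ∷ 0 ∷ []) (0 ∷ 4 ∷ 1 ∷ 1 ∷ 5 ∷ 2 ∷ 2 ∷ 4 ∷ 4 ∷ 3 ∷ 3 ∷ 5 ∷ 5 ∷ 0 ∷ [])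
evenTrails₆≤9 5 q _ _ refl = evenTrails! 3 (2 ∷ 1 ∷ 3 ∷ 4 ∷ 0 ∷ []) (0 ∷ 3 ∷ 3 ∷ 5 ∷ 1 ∷ 1 ∷ 4 ∷ 4 ∷ 2 ∷ 2 ∷ 5 ∷ 5 ∷ 0 ∷ [])
evenTrails₆≤9 6 q _ _ refl = evenTrails! 3 (0 ∷ 2 ∷ 1 ∷ 1 ∷ 3 ∷ 0 ∷ []) (4 ∷ 1 ∷ 5 ∷ 2 ∷ 2 ∷ 4 ∷ 4 ∷ 3 ∷ 3 ∷ 5 ∷ 5 ∷ 0 ∷ [])
evenTrails₆≤9 7 q _ _ refl = evenTrails! 3 (0 ∷ 2 ∷ 1 ∷ 1 ∷ 3 ∷ 4 ∷ 0 ∷ []) (3 ∷ 3 ∷ 5 ∷ 1 ∷ 4 ∷ 4 ∷ 2 ∷ 2 ∷ 5 ∷ 5 ∷ 0 ∷ [])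
evenTrails₆≤9 8 q _ _ refl = evenTrails! 3 (0 ∷ 2 ∷ 1 ∷ 1 ∷ 4 ∷ 3 ∷ 5 ∷ 0 ∷ []) (3 ∷ 3 ∷ 1 ∷ 5 ∷ 5 ∷ 2 ∷ 2 ∷ 4 ∷ 4 ∷ 0 ∷ [])
evenTrails₆≤9 9 q _ _ refl = evenTrails! 3 (0 ∷ 2 ∷ 1 ∷ 1 ∷ 3 ∷ 4 ∷ 1 ∷ 5 ∷ 0 ∷ []) (3 ∷ 3 ∷ 5 ∷ 5 ∷ 2 ∷ 2 ∷ 4 ∷ 4 ∷ 0 ∷ [])
evenTrails₆≤9 (suc (suc (suc (suc (suc (suc (suc (suc (suc (suc p)))))))))) q _ p≤9 eq = ⊥-elim (m+n≮m 9 p p≤9)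

evenTrails₆ : ∀ p q → 3 ≤ p → 3 ≤ q → p + q ≡ 18 → EvenTrails 3 p q
evenTrails₆ p q 3≤p 3≤q eq with p ≤? 9
... | yes p≤9 = evenTrails₆≤9 p q 3≤p p≤9 eq
... | no  p≰9 = swapEven 3 (evenTrails₆≤9 q p 3≤q q≤9 (trans (+-comm q p) eq))
  where
  q≤9 : q ≤ 9
  q≤9 = +-cancelˡ-≤ 9 q 9 (≤-trans (+-monoˡ-≤ q (<⇒≤ (≰⇒> p≰9))) (≤-reflexive eq))

-- Passing from six to eight colours adds 14 edges and gives 32 in all, so `grow` leaves open only
-- 16 + 16.
evenTrails₈-middle : ∀ p q → p ≤ 16 → q ≤ 16 → p + q ≡ 32 → EvenTrails 4 p q
evenTrails₈-middle p q p≤16 q≤16 eq = subst₂ (EvenTrails 4) (sym p≡16) (sym q≡16) trails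
  where
  p≡16 : p ≡ 16
  p≡16 = ≤-antisym p≤16 (+-cancelʳ-≤ 16 16 p (≤-trans (≤-reflexive (sym eq)) (+-monoʳ-≤ p q≤16)))
  q≡16 : q ≡ 16
  q≡16 = ≤-antisym q≤16 (+-cancelˡ-≤ 16 16 q (≤-trans (≤-reflexive (sym eq)) (+-monoˡ-≤ q p≤16)))
  trails : EvenTrails 4 16 16
  trails = evenTrails! 4 (0 ∷ 2 ∷ 1 ∷ 1 ∷ 3 ∷ 0 ∷ 4 ∷ 1 ∷ 5 ∷ 2 ∷ 2 ∷ 4 ∷ 3 ∷ 3 ∷ 5 ∷ 0 ∷ [])
    (6 ∷ 1 ∷ 7 ∷ 2 ∷ 6 ∷ 3 ∷ 7 ∷ 4 ∷ 4 ∷ 6 ∷ 6 ∷ 5 ∷ 5 ∷ 7 ∷ 7 ∷ 0 ∷ [])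

module _ (j : ℕ) where
  private
    k = suc j * 2
    z = suc k
    N = evenLoop k z ≤-refl j
    new = All-evenLoop k z ≤-refl j ≤-refl

    class-new : ∀ {n} → n ≡ k ⊎ n ≡ z → ⌊ n /2⌋ ≡ suc j
    class-new (inj₁ refl) = ⌊n*2/2⌋≡n (suc j)
    class-new (inj₂ refl) = ⌊1+n*2/2⌋≡n (suc j)

    class-old : ∀ {n} → n < k → ⌊ n /2⌋ ≢ suc j
    class-old n<k = <⇒≢ (m<n*2⇒⌊m/2⌋<n (suc j) n<k)

    new⇒EvenLabel : ∀ {l} → (proj₁ l ≡ proj₂ l ⊎ proj₁ l < k) × (proj₂ l ≡ k ⊎ proj₂ l ≡ z) → EvenLabel (suc (suc j) * 2) l
    new⇒EvenLabel (p , q) = [ (λ { refl → n≤1+n _ }) , (λ { refl → ≤-refl }) ]′ q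
      , λ eq → [ id , (λ p<k → ⊥-elim (class-old p<k (trans eq (class-new q)))) ]′ p

  spliceEven : ∀ {C D} → TrailPair (EvenLabel k) C D → TrailPair (EvenLabel (suc (suc j) * 2)) C (D ++ N)
  spliceEven t = splice N t (end-down k z j) (Unique-evenLoop k z ≤-refl j ≤-refl)
    (All.map new⇒EvenLabel new)
    (λ (l< , m) → ≤-trans l< (≤-trans (n≤1+n _) (n≤1+n _)) , m)
    (λ (l< , m) l∈ → class-old l< (class-new (proj₂ (All.lookup new l∈))))

  length-spliceEven : ∀ D → length (D ++ N) ≡ length D + (6 + j * 4)
  length-spliceEven D = trans (length-++ D) (cong (λ n → length D + (6 + n)) (length-down k z j))

  growEven : ∀ {p q} → EvenTrails (suc j) p q → EvenTrails (suc (suc j)) p (q + (6 + j * 4))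
  growEven (C , D , eqC , eqD , t , sep) = C , D ++ N , eqC
    , trans (length-spliceEven D) (cong (_+ (6 + j * 4)) eqD)
    , spliceEven t
    , subst (Separate (labels 0 C)) (sym (labels-closed-++ D N closedʳ))
        (All.zipWith (λ (a , b) → All.++⁺ a b) (sep , All.map far (All.++⁻ˡ (labels 0 C) all)))
    where
    open TrailPair t
    -- The larger end of a new label is `k` or `z`, whose class contains no old vertex, so no loop
    -- of `C` is matched with a new label.
    far : ∀ {l} → EvenLabel k l → All (λ m → ⌊ proj₁ l /2⌋ ≡ ⌊ proj₂ l /2⌋ → ¬ InClass ⌊ proj₁ l /2⌋ m) (labels 0 N)
    far (l< , _) = All.map (λ m eq (_ , q) → class-old l< (trans (sym eq) (trans (sym q) (class-new (proj₂ m))))) new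

evenSize-suc : ∀ j → suc (suc j) * 2 * suc (suc j) ≡ suc j * 2 * suc j + (6 + j * 4)
evenSize-suc = solve-∀

-- The induction starts at six colours: with four, removing the matching leaves a 4-cycle with
-- loops, which has no closed trail of length 3.
evenTrails : ∀ i p q → 3 ≤ p → 3 ≤ q → p + q ≡ (3 + i) * 2 * (3 + i) → EvenTrails (3 + i) p q
evenTrails zero    p q 3≤p 3≤q eq = evenTrails₆ p q 3≤p 3≤q eq
evenTrails (suc i) p q 3≤p 3≤q eq =
  grow (evenTrails i) (growEven (2 + i)) (swapEven (4 + i) ∘ growEven (2 + i) ∘ swapEven (3 + i)) (exceptional i) p q 3≤p 3≤q
       (trans eq (evenSize-suc (2 + i)))
  where
  exceptional : ∀ i p q → p ≤ 2 + (6 + (2 + i) * 4) → q ≤ 2 + (6 + (2 + i) * 4) →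
    p + q ≡ (3 + i) * 2 * (3 + i) + (6 + (2 + i) * 4) → EvenTrails (4 + i) p q
  exceptional zero    p q p≤ q≤ eq = evenTrails₈-middle p q p≤ q≤ eq
  -- From ten colours on, two lengths of at most `2 + N` are too small to reach the total.
  exceptional (suc i) p q p≤ q≤ eq = ⊥-elim (<-irrefl refl (begin-strict
    p + q                                                                ≤⟨ +-mono-≤ p≤ q≤ ⟩
    (2 + (6 + (3 + i) * 4)) + (2 + (6 + (3 + i) * 4))                    <⟨ s≤s (m≤m+n _ (9 + i * 12 + i * i * 2)) ⟩
    suc ((2 + (6 + (3 + i) * 4)) + (2 + (6 + (3 + i) * 4)) + (9 + i * 12 + i * i * 2)) ≡⟨ arith i ⟩
    (4 + i) * 2 * (4 + i) + (6 + (3 + i) * 4)                            ≡⟨ eq ⟨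
    p + q                                                                ∎))
    where
    open ≤-Reasoning
    arith : ∀ i → suc ((2 + (6 + (3 + i) * 4)) + (2 + (6 + (3 + i) * 4)) + (9 + i * 12 + i * i * 2)) ≡
                  (4 + i) * 2 * (4 + i) + (6 + (3 + i) * 4)
    arith = solve-∀

-- For l₂ + l₃ ≤ 3 the closed trail of length l₂ + l₃ − 1 would be too short. There the legs 1 and 2 are the loop
-- and the matching edge at 0, and the prescribed first step of the other trail keeps its fork away from {0, 1}.
LoopTrail : ℕ → Set
LoopTrail j = ∃ λ B → 2 + length B ≡ j * 2 * j × TrailPair (EvenLabel (j * 2)) [ 0 ] (2 ∷ B)

-- Growth appends the new edges at the end of the second trail, so its first step to 2 survives.
loopTrail : ∀ i → LoopTrail (3 + i)
loopTrail zero    = _ , refl , evenPair! 3 [ 0 ] (2 ∷ 1 ∷ 1 ∷ 3 ∷ 0 ∷ 4 ∷ 1 ∷ 5 ∷ 2 ∷ 2 ∷ 4 ∷ 4 ∷ 3 ∷ 3 ∷ 5 ∷ 5 ∷ 0 ∷ [])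
loopTrail (suc i) with B , eq , t ← loopTrail i = _ ,
  trans (cong suc (length-spliceEven (2 + i) (2 ∷ B))) (trans (cong (_+ (6 + (2 + i) * 4)) eq) (sym (evenSize-suc (2 + i)))) ,
  spliceEven (2 + i) t

-- Matching edges and forks

edgeClass : ∀ {i} a b → ⌊ a /2⌋ ≡ i → ⌊ b /2⌋ ≡ i → InClass i (edge a b)
edgeClass a b p q with edge-sel a b
... | inj₁ eq = subst (InClass _) (sym eq) (p , q)
... | inj₂ eq = subst (InClass _) (sym eq) (q , p)

matching : ℕ → Label
matching m = edge m (mate m)

matching-class : ∀ m → InClass ⌊ m /2⌋ (matching m)
matching-class m = edgeClass m (mate m) refl (⌊mate/2⌋ m)

matching-notLoop : ∀ m → proj₁ (matching m) ≢ proj₂ (matching m)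
matching-notLoop m with edge-sel m (mate m)
... | inj₁ eq = subst (λ l → proj₁ l ≢ proj₂ l) (sym eq) (mate≢ m ∘ sym)
... | inj₂ eq = subst (λ l → proj₁ l ≢ proj₂ l) (sym eq) (mate≢ m)

matching-bound : ∀ {m} j → m < j * 2 → proj₂ (matching m) < j * 2
matching-bound j m< = ⊔-lub m< (mate< j m<)

matching-fresh : ∀ {k ls} m → All (EvenLabel k) ls → All (matching m ≢_) ls
matching-fresh m = All.map λ { (_ , straight) refl →
  matching-notLoop m (straight (trans (proj₁ (matching-class m)) (sym (proj₂ (matching-class m))))) }

-- The two matching edges differ because `m` and `n` lie in different classes, and neither occurs in
-- the trails, whose labels within a class are loops.
withMatching : ∀ {C D} j m n → TrailPair (EvenLabel (j * 2)) C D → m < j * 2 → n < j * 2 → ⌊ m /2⌋ ≢ ⌊ n /2⌋ →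
  let L = (matching m ∷ labels 0 C) ++ (matching n ∷ labels 0 D) in Unique L × All (OddLabel (j * 2)) L
withMatching {C} {D} j m n t m< n< m≢n =
    Unique-resp-↭ (Perm.prep _ perm)
      ( ((λ eq → m≢n (trans (sym (proj₁ (matching-class m))) (trans (cong (⌊_/2⌋ ∘ proj₁) eq) (proj₁ (matching-class n)))))
          ∷ matching-fresh m all)
      ∷ matching-fresh n all ∷ unique)
  , Perm.All-resp-↭ (Perm.prep _ perm) (matching-bound j m< ∷ matching-bound j n< ∷ All.map proj₁ all)
  where
  open TrailPair t
  perm : matching n ∷ labels 0 C ++ labels 0 D ↭ labels 0 C ++ matching n ∷ labels 0 D
  perm = ↭-sym (Perm.shift (matching n) (labels 0 C) (labels 0 D))

-- Two walks from 0 that meet at m and cover the closed trail C, one of them prolonged by the matching edge at m.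
record Fork (C : List ℕ) (a c m : ℕ) : Set where
  field
    out in′  : List ℕ
    long-out : a ≤ length out
    long-in  : c ≤ length in′
    cover    : labels 0 out ++ labels 0 in′ ↭ matching m ∷ labels 0 C

length-∷ʳ : ∀ (xs : List ℕ) x → length (xs ++ [ x ]) ≡ suc (length xs)
length-∷ʳ xs x = trans (length-++ xs) (+-comm _ 1)

forkˡ : ∀ A B → end 0 (A ++ B) ≡ 0 → Fork (A ++ B) (suc (length A)) (length B) (end 0 A)
forkˡ A B closed = record
  { out      = A ++ [ mate (end 0 A) ]
  ; in′      = back (end 0 A) B
  ; long-out = ≤-reflexive (sym (length-∷ʳ A _))
  ; long-in  = ≤-reflexive (sym (length-back (end 0 A) B))
  ; cover    = labels-forkˡ A B closed (mate (end 0 A))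
  }

forkʳ : ∀ A B → end 0 (A ++ B) ≡ 0 → Fork (A ++ B) (length A) (suc (length B)) (end 0 A)
forkʳ A B closed = record
  { out      = A
  ; in′      = back (end 0 A) B ++ [ mate (end 0 A) ]
  ; long-out = ≤-refl
  ; long-in  = ≤-reflexive (sym (trans (length-∷ʳ (back (end 0 A) B) _) (cong suc (length-back (end 0 A) B))))
  ; cover    = labels-forkʳ A B closed (mate (end 0 A))
  }

shrink : ∀ {C a c a′ c′ m} → a′ ≤ a → c′ ≤ c → Fork C a c m → Fork C a′ c′ m
shrink a′≤ c′≤ f = record { Fork f ; long-out = ≤-trans a′≤ (Fork.long-out f) ; long-in = ≤-trans c′≤ (Fork.long-in f) }

-- Legs of given lengths can fork at either end of an edge of the closed trail; this choice makes it possible to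
-- use different matching edges at the forks of two closed trails.
forks : ∀ a c C → end 0 C ≡ 0 → a + suc c ≤ length C →
  ∃₂ λ u v → edge u v ∈ labels 0 C × Fork C (suc a) (suc c) u × Fork C (suc a) (suc c) v
forks a c C closed b with split a (suc c) C b
... | A , x ∷ B , refl , refl , s≤s c≤ = end 0 A , x
  , subst (_ ∈_) (sym (labels-++ 0 A (x ∷ B))) (∈-++⁺ʳ (labels 0 A) (here refl))
  -- Cutting before `x` and prolonging the first walk, or cutting after `x` and prolonging the
  -- second, gives the same two lengths.
  , shrink ≤-refl (s≤s c≤) (forkˡ A (x ∷ B) closed)
  , shrink (≤-reflexive (sym (length-∷ʳ A x))) (s≤s c≤)
      (subst₂ (λ C m → Fork C (length (A ++ [ x ])) (suc (length B)) m) reassoc (end-++ 0 A [ x ])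
        (forkʳ (A ++ [ x ]) B (trans (cong (end 0) reassoc) closed)))
  where
  reassoc : (A ++ [ x ]) ++ B ≡ A ++ x ∷ B
  reassoc = ++-assoc A [ x ] B

outerInnerColouring : ∀ {C D l₁ l₂ l₃ l₄} j m n → TrailPair (EvenLabel (j * 2)) C D → m < j * 2 → n < j * 2 →
  ⌊ m /2⌋ ≢ ⌊ n /2⌋ → Fork C l₂ l₃ m → Fork D l₁ l₄ n → EDColorable (Spider l₁ l₂ l₃ l₄) (j * 2)
outerInnerColouring j m n t m< n< m≢n f g =
  let un , al = withMatching j m n t m< n< m≢n in
  colourByLegs (≤-<-trans z≤n m<) G.out F.out F.in′ G.in′ G.long-out F.long-out F.long-in G.long-in
    (↭-trans (outer-inner (labels 0 G.out) (labels 0 F.out) _ _) (Perm.++⁺ F.cover G.cover)) un al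
  where
  module F = Fork f
  module G = Fork g

consecutiveColouring : ∀ {C D l₁ l₂ l₃ l₄} j m n → TrailPair (EvenLabel (j * 2)) C D → m < j * 2 → n < j * 2 →
  ⌊ m /2⌋ ≢ ⌊ n /2⌋ → Fork C l₁ l₂ m → Fork D l₃ l₄ n → EDColorable (Spider l₁ l₂ l₃ l₄) (j * 2)
consecutiveColouring j m n t m< n< m≢n f g =
  let un , al = withMatching j m n t m< n< m≢n in
  colourByLegs (≤-<-trans z≤n m<) F.out F.in′ G.out G.in′ F.long-out F.long-in G.long-out G.long-in
    (↭-trans (↭-reflexive (sym (++-assoc (labels 0 F.out) _ _))) (Perm.++⁺ F.cover G.cover)) un al
  where
  module F = Fork f
  module G = Fork g

edge-bound : ∀ {k ls u v} → All (λ l → proj₂ l < k) ls → edge u v ∈ ls → u < k × v < k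
edge-bound {u = u} {v} al e∈ = ≤-<-trans (m≤m⊔n u v) (All.lookup al e∈) , ≤-<-trans (m≤n⊔m u v) (All.lookup al e∈)

-- Two edges each offer a choice of fork vertex; the choice fails only if all four ends share one
-- class.
distinctClasses : ∀ u v s t → ¬ (⌊ u /2⌋ ≡ ⌊ v /2⌋ × ⌊ s /2⌋ ≡ ⌊ u /2⌋ × ⌊ t /2⌋ ≡ ⌊ u /2⌋) →
  ∃₂ λ m n → (m ≡ u ⊎ m ≡ v) × (n ≡ s ⊎ n ≡ t) × ⌊ m /2⌋ ≢ ⌊ n /2⌋
distinctClasses u v s t ne with ⌊ u /2⌋ ≟ ⌊ s /2⌋ | ⌊ u /2⌋ ≟ ⌊ t /2⌋ | ⌊ v /2⌋ ≟ ⌊ s /2⌋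
... | no us | _      | _      = u , s , inj₁ refl , inj₁ refl , us
... | yes _ | no ut  | _      = u , t , inj₁ refl , inj₂ refl , ut
... | yes _ | yes _  | no vs  = v , s , inj₂ refl , inj₁ refl , vs
... | yes p | yes q  | yes r  = ⊥-elim (ne (trans p (sym r) , sym p , sym q))

either : ∀ {u v m : ℕ} (P : ℕ → Set) → P u → P v → m ≡ u ⊎ m ≡ v → P m
either P pu pv (inj₁ refl) = pu
either P pu pv (inj₂ refl) = pv

fromEvenTrails : ∀ {p q} j a b c d → EvenTrails j p q → b + suc c ≤ p → a + suc d ≤ q →
  EDColorable (Spider (suc a) (suc b) (suc c) (suc d)) (j * 2)
fromEvenTrails j a b c d (C , D , refl , refl , t , sep) ≤p ≤q =
  let u , v , uv∈ , fu , fv = forks b c C closedˡ ≤p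
      s , w , sw∈ , fs , fw = forks a d D closedʳ ≤q
      u< , v< = edge-bound (All.map proj₁ (All.++⁻ˡ (labels 0 C) all)) uv∈
      s< , w< = edge-bound (All.map proj₁ (All.++⁻ʳ (labels 0 C) all)) sw∈
      -- All four ends in one class would mean that both trails have an edge within that class,
      -- which `sep` excludes.
      m , n , m∈ , n∈ , m≢n = distinctClasses u v s w λ (uv , su , wu) →
        let cl = edgeClass {⌊ u /2⌋} u v refl (sym uv) in
        All.lookup (All.lookup sep uv∈) sw∈ (trans (proj₁ cl) (sym (proj₂ cl)))
          (subst (λ i → InClass i (edge s w)) (sym (proj₁ cl)) (edgeClass s w su wu))
  in outerInnerColouring j m n t (either (_< j * 2) u< v< m∈) (either (_< j * 2) s< w< n∈) m≢n
       (either (Fork C _ _) fu fv m∈) (either (Fork D _ _) fs fw n∈)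
  where open TrailPair t

-- Colourings of spiders from the trails

loopColouring₁ : ∀ i l₄ → 3 + l₄ ≤ (3 + i) * 2 * (3 + i) + 2 → EDColorable (Spider 1 1 1 l₄) ((3 + i) * 2)
loopColouring₁ i l₄ b with B , eq , t ← loopTrail i =
  consecutiveColouring (3 + i) 0 2 t (s≤s z≤n) (s≤s (s≤s (s≤s z≤n))) (λ ()) (forkˡ [] [ 0 ] refl)
    (shrink ≤-refl l₄≤ (forkʳ [ 2 ] B (TrailPair.closedʳ t)))
  where
  l₄≤ : l₄ ≤ suc (length B)
  l₄≤ = +-cancelˡ-≤ 3 _ _ (≤-trans b (≤-reflexive (trans (cong (_+ 2) (sym eq)) (+-comm (2 + length B) 2))))

-- Here the matching edge {2, 3} prolongs the third leg to two edges; for `loopColouring₁` it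
-- prolongs the fourth.
loopColouring₂ : ∀ i l₄ → 4 + l₄ ≤ (3 + i) * 2 * (3 + i) + 2 → EDColorable (Spider 1 1 2 l₄) ((3 + i) * 2)
loopColouring₂ i l₄ b with B , eq , t ← loopTrail i =
  consecutiveColouring (3 + i) 0 2 t (s≤s z≤n) (s≤s (s≤s (s≤s z≤n))) (λ ()) (forkˡ [] [ 0 ] refl)
    (shrink ≤-refl l₄≤ (forkˡ [ 2 ] B (TrailPair.closedʳ t)))
  where
  l₄≤ : l₄ ≤ length B
  l₄≤ = +-cancelˡ-≤ 4 _ _ (≤-trans b (≤-reflexive (trans (cong (_+ 2) (sym eq)) (+-comm (2 + length B) 2))))

-- Each pair of legs gains one matching edge, so the trails need only l₂ + l₃ - 1 and l₁ + l₄ - 1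
-- edges. The hypothesis `2 ≤ b + c` makes the first of these lengths at least 3.
wideEvenColouring : ∀ i a b c d → 2 ≤ b + c → b ≤ c → c ≤ d →
  suc a + suc b + suc c + suc d ≤ (3 + i) * 2 * (3 + i) + 2 →
  EDColorable (Spider (suc a) (suc b) (suc c) (suc d)) ((3 + i) * 2)
wideEvenColouring i a b c d 2≤ b≤c c≤d total =
  fromEvenTrails (3 + i) a b c d (evenTrails i p (M ∸ p) 3≤p 3≤q (m+[n∸m]≡n p≤M)) ≤-refl rest
  where
  M = (3 + i) * 2 * (3 + i)
  p = b + suc c
  3≤p : 3 ≤ p
  3≤p = subst (3 ≤_) (sym (+-suc b c)) (s≤s 2≤)
  rearrange : ∀ a b c d → suc a + suc b + suc c + suc d ≡ (a + suc d) + (b + suc c) + 2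
  rearrange = solve-∀
  sum≤M : (a + suc d) + p ≤ M
  sum≤M = +-cancelʳ-≤ 2 _ _ (subst (_≤ M + 2) (rearrange a b c d) total)
  p≤M : p ≤ M
  p≤M = m+n≤o⇒n≤o (a + suc d) sum≤M
  rest : a + suc d ≤ M ∸ p
  rest = m+n≤o⇒m≤o∸n _ sum≤M
  18≤M : 18 ≤ M
  18≤M = *-mono-≤ (*-monoˡ-≤ 2 (m≤m+n 3 i)) (m≤m+n 3 i)
  3≤q : 3 ≤ M ∸ p
  3≤q with 3 ≤? a + suc d
  ... | yes 3≤ = ≤-trans 3≤ rest
  -- If the outer legs are short then so are the middle ones: `p` is at most 3, and the remainder of
  -- `M`, which is at least 18, is long enough.
  ... | no 3≰  = m+n≤o⇒m≤o∸n 3 (≤-trans (+-monoʳ-≤ 3 (+-mono-≤ (≤-trans b≤c c≤1) (s≤s c≤1))) (≤-trans (m≤m+n 6 12) 18≤M))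
    where
    c≤1 : c ≤ 1
    c≤1 = ≤-trans c≤d (≤-pred (m+n≤o⇒n≤o a (≤-pred (≰⇒> 3≰))))

evenColouring : ∀ i {l₁ l₂ l₃ l₄} → 1 ≤ l₁ → l₁ ≤ l₂ → l₂ ≤ l₃ → l₃ ≤ l₄ →
  l₁ + l₂ + l₃ + l₄ ≤ (3 + i) * 2 * (3 + i) + 2 → EDColorable (Spider l₁ l₂ l₃ l₄) ((3 + i) * 2)
evenColouring i {suc zero} {suc zero} {suc zero}       {l₄} _ _ _ _ total = loopColouring₁ i l₄ total
evenColouring i {suc zero} {suc zero} {suc (suc zero)} {l₄} _ _ _ _ total = loopColouring₂ i l₄ total
evenColouring i {suc (suc a)} {suc zero} _ (s≤s ()) _ _ total
evenColouring i {suc zero} {suc zero} {suc (suc (suc c))} {suc d} _ _ (s≤s b≤c) (s≤s c≤d) total =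
  wideEvenColouring i 0 0 (2 + c) d (s≤s (s≤s z≤n)) b≤c c≤d total
evenColouring i {suc a} {suc (suc b)} {suc (suc c)} {suc d} _ _ (s≤s b≤c) (s≤s c≤d) total =
  wideEvenColouring i a (suc b) (suc c) d (s≤s (≤-trans (s≤s z≤n) (m≤n+m (suc c) b))) b≤c c≤d total

oddColouring : ∀ i {l₁ l₂ l₃ l₄} → 1 ≤ l₁ → 1 ≤ l₂ → 2 ≤ l₃ → l₃ ≤ l₄ →
  l₁ + l₂ + l₃ + l₄ ≤ suc ((2 + i) * 2) * suc (2 + i) → EDColorable (Spider l₁ l₂ l₃ l₄) (suc ((2 + i) * 2))
oddColouring i {l₁} {l₂} {l₃} {l₄} 1≤l₁ 1≤l₂ 2≤l₃ l₃≤l₄ total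
  = let C , D , eqC , eqD , t = oddTrails i (l₂ + l₃) (M ∸ (l₂ + l₃)) (+-mono-≤ 1≤l₂ 2≤l₃)
          (≤-trans (+-mono-≤ 1≤l₁ (≤-trans 2≤l₃ l₃≤l₄)) rest) (m+[n∸m]≡n (m+n≤o⇒n≤o (l₁ + l₄) total′))
    in fromOddTrails (s≤s z≤n) t (≤-reflexive (sym eqC)) (subst (l₁ + l₄ ≤_) (sym eqD) rest)
  where
  M = suc ((2 + i) * 2) * suc (2 + i)
  rearrange : ∀ a b c d → a + b + c + d ≡ (a + d) + (b + c)
  rearrange = solve-∀
  total′ : (l₁ + l₄) + (l₂ + l₃) ≤ M
  total′ = subst (_≤ M) (rearrange l₁ l₂ l₃ l₄) total
  rest : l₁ + l₄ ≤ M ∸ (l₂ + l₃)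
  rest = m+n≤o⇒m≤o∸n _ total′

oddColouring₁ : ∀ i l₄ → 4 + l₄ ≤ suc ((2 + i) * 2) * suc (2 + i) → EDColorable (Spider 1 1 1 l₄) (suc ((2 + i) * 2))
oddColouring₁ i l₄ total
  -- Legs 2 and 3 have two edges together, but the trails have length at least 3. One edge of the
  -- first trail stays uncoloured, which accounts for `4 + l₄` instead of `3 + l₄`.
  = let C , D , eqC , eqD , t = oddTrails i 3 (M ∸ 3) ≤-refl
          (m+n≤o⇒m≤o∸n 3 (≤-trans (m≤m+n 6 9) 15≤M)) (m+[n∸m]≡n (≤-trans (m≤m+n 3 12) 15≤M))
    in fromOddTrails (s≤s z≤n) t (subst (2 ≤_) (sym eqC) (n≤1+n 2))
      (subst (1 + l₄ ≤_) (sym eqD) (m+n≤o⇒m≤o∸n (1 + l₄) (subst (_≤ M) (+-comm 3 (1 + l₄)) total)))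
  where
  M = suc ((2 + i) * 2) * suc (2 + i)
  15≤M : 15 ≤ M
  15≤M = *-mono-≤ (s≤s (*-monoˡ-≤ 2 (m≤m+n 2 i))) (m≤m+n 3 i)

-- At most ten edges: explicit colourings with four colours

fourColouring! : ∀ w₂ w₃ w₄ {l₂ l₃ l₄} → l₂ ≤ length w₂ → l₃ ≤ length w₃ → l₄ ≤ length w₄ →
  let L = labels 0 [ 0 ] ++ labels 0 w₂ ++ labels 0 w₃ ++ labels 0 w₄ in
  {_ : True (unique? _≟ₗ_ L)} {_ : True (All.all? (λ l → proj₂ l <? 4) L)} → EDColorable (Spider 1 l₂ l₃ l₄) 4
fourColouring! w₂ w₃ w₄ b₂ b₃ b₄ {u} {a} = colourByLegs (s≤s z≤n) [ 0 ] w₂ w₃ w₄ ≤-refl b₂ b₃ b₄ ↭-refl (toWitness u) (toWitness a)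

-- The first leg is the loop at 0. For each possible l₂, l₃ the fourth walk has the largest length 9
-- - l₂ - l₃, so that all ten labels are used; a shorter fourth leg follows a prefix. The remaining
-- pairs contradict the order or the total.
fourColouring : ∀ l₂ l₃ l₄ → 1 ≤ l₂ → l₂ ≤ l₃ → l₃ ≤ l₄ → l₂ + l₃ + l₄ ≤ 9 → EDColorable (Spider 1 l₂ l₃ l₄) 4
fourColouring 1 1 l₄ _ _ _ b = fourColouring! (1 ∷ []) (2 ∷ []) (3 ∷ 1 ∷ 1 ∷ 2 ∷ 2 ∷ 3 ∷ 3 ∷ []) ≤-refl ≤-refl (+-cancelˡ-≤ 2 _ _ b)
fourColouring 1 2 l₄ _ _ _ b = fourColouring! (1 ∷ []) (2 ∷ 2 ∷ []) (3 ∷ 1 ∷ 1 ∷ 2 ∷ 3 ∷ 3 ∷ []) ≤-refl ≤-refl (+-cancelˡ-≤ 3 _ _ b)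
fourColouring 1 3 l₄ _ _ _ b = fourColouring! (1 ∷ []) (2 ∷ 2 ∷ 3 ∷ []) (3 ∷ 3 ∷ 1 ∷ 1 ∷ 2 ∷ []) ≤-refl ≤-refl (+-cancelˡ-≤ 4 _ _ b)
fourColouring 1 4 l₄ _ _ _ b = fourColouring! (1 ∷ []) (2 ∷ 1 ∷ 1 ∷ 3 ∷ []) (3 ∷ 3 ∷ 2 ∷ 2 ∷ []) ≤-refl ≤-refl (+-cancelˡ-≤ 5 _ _ b)
fourColouring 2 2 l₄ _ _ _ b = fourColouring! (1 ∷ 1 ∷ []) (2 ∷ 2 ∷ []) (3 ∷ 1 ∷ 2 ∷ 3 ∷ 3 ∷ []) ≤-refl ≤-refl (+-cancelˡ-≤ 4 _ _ b)
fourColouring 2 3 l₄ _ _ _ b = fourColouring! (1 ∷ 1 ∷ []) (2 ∷ 1 ∷ 3 ∷ []) (3 ∷ 3 ∷ 2 ∷ 2 ∷ []) ≤-refl ≤-refl (+-cancelˡ-≤ 5 _ _ b)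
fourColouring 3 3 l₄ _ _ _ b = fourColouring! (1 ∷ 1 ∷ 2 ∷ []) (2 ∷ 2 ∷ 3 ∷ []) (3 ∷ 3 ∷ 1 ∷ []) ≤-refl ≤-refl (+-cancelˡ-≤ 6 _ _ b)
fourColouring 2 1 l₄ _ (s≤s ()) _ b
fourColouring (suc (suc (suc l₂))) 1 l₄ _ (s≤s ()) _ b
fourColouring (suc (suc (suc l₂))) 2 l₄ _ (s≤s (s≤s ())) _ b
fourColouring (suc (suc (suc (suc l₂)))) 3 l₄ _ (s≤s (s≤s (s≤s ()))) _ b
fourColouring (suc (suc l₂)) (suc (suc (suc (suc l₃)))) l₄ _ _ l₃≤l₄ b =
  ⊥-elim (<⇒≱ (+-mono-≤ (+-mono-≤ (m≤m+n 2 l₂) (m≤m+n 4 l₃)) (≤-trans (m≤m+n 4 l₃) l₃≤l₄)) b)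
fourColouring 1 (suc (suc (suc (suc (suc l₃))))) l₄ _ _ l₃≤l₄ b =
  ⊥-elim (<⇒≱ (≤-trans (n≤1+n 10) (+-mono-≤ (+-monoʳ-≤ 1 (m≤m+n 5 l₃)) (≤-trans (m≤m+n 5 l₃) l₃≤l₄))) b)

-- Degrees of colours

sum-mono : ∀ {n} {f g : Fin n → ℕ} → (∀ i → f i ≤ g i) → sum f ≤ sum g
sum-mono {zero}  f≤g = z≤n
sum-mono {suc n} f≤g = +-mono-≤ (f≤g Fin.zero) (sum-mono (f≤g ∘ Fin.suc))

sum-const : ∀ n c → sum {n} (λ _ → c) ≡ n * c
sum-const zero    c = refl
sum-const (suc n) c = cong (c +_) (sum-const n c)

sum-zero : ∀ {n} {f : Fin n → ℕ} → (∀ i → f i ≡ 0) → sum f ≡ 0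
sum-zero {n} f≡0 = trans (sum-cong-≗ f≡0) (trans (sum-const n 0) (*-zeroʳ n))

sum≢0⇒∃ : ∀ {n} (f : Fin n → ℕ) → sum f ≢ 0 → ∃ λ i → f i ≢ 0
sum≢0⇒∃ {zero}  f ne = ⊥-elim (ne refl)
sum≢0⇒∃ {suc n} f ne with f Fin.zero ≟ 0
... | no  f₀≢0 = Fin.zero , f₀≢0
... | yes f₀≡0 =
  let i , fi = sum≢0⇒∃ (f ∘ Fin.suc) (λ rest≡0 → ne (cong₂ _+_ f₀≡0 rest≡0)) in Fin.suc i , fi

sum≤-support : ∀ {n} (f : Fin n → ℕ) B → (∀ i → f i ≤ B) → (∀ i j → f i ≢ 0 → f j ≢ 0 → i ≡ j) → sum f ≤ B
sum≤-support {zero}  f B f≤ uniq = z≤n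
sum≤-support {suc n} f B f≤ uniq with f Fin.zero ≟ 0
... | yes f₀≡0 rewrite f₀≡0 =
  sum≤-support (f ∘ Fin.suc) B (f≤ ∘ Fin.suc) (λ i j p q → Fin.suc-injective (uniq (Fin.suc i) (Fin.suc j) p q))
... | no  f₀≢0 = ≤-trans (≤-reflexive (trans (cong (f Fin.zero +_) (sum-zero rest≡0)) (+-identityʳ _))) (f≤ Fin.zero)
  where
  rest≡0 : ∀ i → f (Fin.suc i) ≡ 0
  rest≡0 i with f (Fin.suc i) ≟ 0
  ... | yes eq = eq
  ... | no  ne with () ← uniq Fin.zero (Fin.suc i) f₀≢0 ne

δ : ∀ {m} → Fin m → Fin m → ℕ
δ a v with a Fin.≟ v
... | yes _ = 1
... | no  _ = 0

δ-refl : ∀ {m} (a : Fin m) → δ a a ≡ 1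
δ-refl a with a Fin.≟ a
... | yes _ = refl
... | no ne = ⊥-elim (ne refl)

δ-≢ : ∀ {m} {a v : Fin m} → a ≢ v → δ a v ≡ 0
δ-≢ {a = a} {v} ne with a Fin.≟ v
... | yes eq = ⊥-elim (ne eq)
... | no  _  = refl

δ≢0 : ∀ {m} {a v : Fin m} → δ a v ≢ 0 → a ≡ v
δ≢0 {a = a} {v} ne with a Fin.≟ v
... | yes eq = eq
... | no  _  = ⊥-elim (ne refl)

δ≤1 : ∀ {m} (a v : Fin m) → δ a v ≤ 1
δ≤1 a v with a Fin.≟ v
... | yes _ = ≤-refl
... | no  _ = z≤n

sum-single : ∀ {m} (f : Fin m → ℕ) a → (∀ v → v ≢ a → f v ≡ 0) → sum f ≡ f a
sum-single {suc m} f Fin.zero    z = trans (cong (f Fin.zero +_) (sum-zero (λ v → z (Fin.suc v) (λ ())))) (+-identityʳ _)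
sum-single {suc m} f (Fin.suc a) z = trans (cong (_+ sum (f ∘ Fin.suc)) (z Fin.zero (λ ())))
  (sum-single (f ∘ Fin.suc) a (λ v v≢a → z (Fin.suc v) (v≢a ∘ Fin.suc-injective)))

sum-δ : ∀ {m} (a : Fin m) → sum (δ a) ≡ 1
sum-δ a = trans (sum-single (δ a) a (λ v v≢a → δ-≢ (v≢a ∘ sym))) (δ-refl a)

first : ∀ {n} → 1 ≤ n → Fin n
first (s≤s _) = Fin.zero

last : ∀ {n} → 1 ≤ n → Fin n
last {suc n} _ = fromℕ n

prevIdx-first : ∀ {n} (p : 1 ≤ n) → prevIdx (first p) ≡ nothing
prevIdx-first (s≤s _) = refl

second : ∀ {n} (p : 2 ≤ n) → ∃ λ j → prevIdx {n} j ≡ just (first (≤-trans (s≤s z≤n) p)) × (∀ q → j ≢ first q)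
second (s≤s (s≤s _)) = Fin.suc Fin.zero , refl , λ { (s≤s _) () }

-- Every inner vertex of a leg is an end of two edges.
leg-parity : ∀ {n} (p : 1 ≤ n) (g : Maybe (Fin n) → ℕ) →
  ∃ λ X → sum (λ j → g (prevIdx j) + g (just j)) ≡ g nothing + g (just (last p)) + 2 * X
leg-parity {suc zero}    p g = 0 , refl
leg-parity {suc (suc n)} p g =
  let X , eq = leg-parity {suc n} (s≤s z≤n) g′
  in  g (just Fin.zero) + X , (begin
    g nothing + a + sum (λ j → g (just (Fin.inject₁ j)) + g (just (Fin.suc j)))
      ≡⟨ cong (g nothing + a +_) (trans (sum-cong-≗ (λ j → cong (_+ g (just (Fin.suc j))) (shift j))) eq) ⟩
    g nothing + a + (a + z + 2 * X)          ≡⟨ arith (g nothing) a z X ⟩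
    g nothing + z + 2 * (a + X)              ∎)
  where
  open ≡-Reasoning
  a = g (just Fin.zero)
  z = g (just (Fin.suc (fromℕ n)))
  -- The first vertex of the leg becomes the centre of the shorter leg.
  g′ : Maybe (Fin (suc n)) → ℕ
  g′ nothing  = a
  g′ (just j) = g (just (Fin.suc j))
  shift : ∀ j → g (just (Fin.inject₁ j)) ≡ g′ (prevIdx j)
  shift Fin.zero    = refl
  shift (Fin.suc j) = refl
  arith : ∀ x a z X → x + a + (a + z + 2 * X) ≡ x + z + 2 * (a + X)
  arith = solve-∀

-- Lower bounds on the number of colours

module Colouring {m l₁ l₂ l₃ l₄ : ℕ} (pos : ∀ i → 1 ≤ legs l₁ l₂ l₃ l₄ i) (colouring : EDColorable (Spider l₁ l₂ l₃ l₄) m) where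

  private
    G = Spider l₁ l₂ l₃ l₄
    ℓ = legs l₁ l₂ l₃ l₄
    c = proj₁ colouring
    distinguishing = proj₂ colouring

  size : ℕ
  size = l₁ + l₂ + l₃ + l₄

  centre : Fin m
  centre = c nothing

  head : Fin 4 → Fin m
  head i = c (just (i , first (pos i)))

  leaf : Fin 4 → Fin m
  leaf i = c (just (i , last (pos i)))

  c₁ c₂ : E G → Fin m
  c₁ e = c (end₁ G e)
  c₂ e = c (end₂ G e)

  c₁-first : ∀ i → c₁ (i , first (pos i)) ≡ centre
  c₁-first i = cong (c ∘ Maybe.map (i ,_)) (prevIdx-first (pos i))

  -- The first edges of all legs share the centre, so their other ends must have different colours.
  head-injective : ∀ {i j} → head i ≡ head j → i ≡ j
  head-injective {i} {j} eq = cong proj₁ (distinguishing (i , first (pos i)) (j , first (pos j))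
    (inj₁ (trans (c₁-first i) (sym (c₁-first j)) , eq)))

  4≤m : 4 ≤ m
  4≤m = injective⇒≤ head-injective

  sumE : (E G → ℕ) → ℕ
  sumE f = sum (λ i → sum (λ j → f (i , j)))

  sumE-cong : ∀ {f g} → (∀ e → f e ≡ g e) → sumE f ≡ sumE g
  sumE-cong eq = sum-cong-≗ (λ i → sum-cong-≗ (λ j → eq (i , j)))

  sumE-comm : ∀ {n} (f : Fin n → E G → ℕ) → sum (λ v → sumE (f v)) ≡ sumE (λ e → sum (λ v → f v e))
  sumE-comm f = trans (∑-comm (λ v i → sum (λ j → f v (i , j)))) (sum-cong-≗ (λ i → ∑-comm (λ v j → f v (i , j))))

  sumE≤-support : ∀ f B → (∀ e → f e ≤ B) → (∀ e e′ → f e ≢ 0 → f e′ ≢ 0 → e ≡ e′) → sumE f ≤ B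
  sumE≤-support f B f≤ uniq = sum≤-support _ B
    (λ i → sum≤-support _ B (λ j → f≤ (i , j)) (λ j j′ p q → index≡ (uniq (i , j) (i , j′) p q)))
    (λ i i′ p q → let j , fj = sum≢0⇒∃ _ p ; j′ , fj′ = sum≢0⇒∃ _ q in cong proj₁ (uniq (i , j) (i′ , j′) fj fj′))
    where
    index≡ : ∀ {i} {j j′ : Fin (ℓ i)} → _≡_ {A = E G} (i , j) (i , j′) → j ≡ j′
    index≡ refl = refl

  degree : Fin m → ℕ
  degree v = sumE (λ e → δ (c₁ e) v + δ (c₂ e) v)

  sum-degree : sum degree ≡ 2 * size
  sum-degree = begin
    sum degree                                            ≡⟨ sumE-comm (λ v e → δ (c₁ e) v + δ (c₂ e) v) ⟩
    sumE (λ e → sum (λ v → δ (c₁ e) v + δ (c₂ e) v))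
      ≡⟨ sumE-cong (λ e → trans (∑-distrib-+ (δ (c₁ e)) (δ (c₂ e))) (cong₂ _+_ (sum-δ (c₁ e)) (sum-δ (c₂ e)))) ⟩
    sumE (λ e → 2)                                        ≡⟨ sum-cong-≗ (λ i → sum-const (ℓ i) 2) ⟩
    l₁ * 2 + (l₂ * 2 + (l₃ * 2 + (l₄ * 2 + 0)))           ≡⟨ arith l₁ l₂ l₃ l₄ ⟩
    2 * size                                              ∎
    where
    open ≡-Reasoning
    arith : ∀ a b c d → a * 2 + (b * 2 + (c * 2 + (d * 2 + 0))) ≡ 2 * (a + b + c + d)
    arith = solve-∀

  private
    -- The number of ends of `e` coloured `v` whose opposite end is coloured `w`; a loop counts
    -- twice when `v` and `w` agree with its colour.
    incidence : Fin m → Fin m → E G → ℕ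
    incidence v w e = δ (c₁ e) v * δ (c₂ e) w + δ (c₂ e) v * δ (c₁ e) w

    *≢0 : ∀ a b → a * b ≢ 0 → a ≢ 0 × b ≢ 0
    *≢0 a b ne = (λ { refl → ne refl }) , (λ { refl → ne (*-zeroʳ a) })

    incidence≢0 : ∀ v w e → incidence v w e ≢ 0 → (c₁ e ≡ v × c₂ e ≡ w) ⊎ (c₂ e ≡ v × c₁ e ≡ w)
    incidence≢0 v w e ne with δ (c₁ e) v * δ (c₂ e) w ≟ 0
    ... | no  p = let a , b = *≢0 (δ (c₁ e) v) _ p in inj₁ (δ≢0 a , δ≢0 b)
    ... | yes p = let a , b = *≢0 (δ (c₂ e) v) _ (ne ∘ cong₂ _+_ p) in inj₂ (δ≢0 a , δ≢0 b)

    same : ∀ {v w} e f → (c₁ e ≡ v × c₂ e ≡ w) ⊎ (c₂ e ≡ v × c₁ e ≡ w) → (c₁ f ≡ v × c₂ f ≡ w) ⊎ (c₂ f ≡ v × c₁ f ≡ w) →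
      SameLabel (c₁ e) (c₂ e) (c₁ f) (c₂ f)
    same e f (inj₁ (p , q)) (inj₁ (r , s)) = inj₁ (trans p (sym r) , trans q (sym s))
    same e f (inj₁ (p , q)) (inj₂ (r , s)) = inj₂ (trans p (sym r) , trans q (sym s))
    same e f (inj₂ (p , q)) (inj₁ (r , s)) = inj₂ (trans q (sym s) , trans p (sym r))
    same e f (inj₂ (p , q)) (inj₂ (r , s)) = inj₁ (trans q (sym s) , trans p (sym r))

    product≤1 : ∀ a b v w → δ {m} a v * δ {m} b w ≤ 1
    product≤1 a b v w = *-mono-≤ (δ≤1 a v) (δ≤1 b w)

    incidence≤ : ∀ v w e → incidence v w e ≤ 1 + δ v w
    incidence≤ v w e with δ (c₁ e) v * δ (c₂ e) w ≟ 0
    ... | yes p rewrite p = ≤-trans (product≤1 (c₂ e) (c₁ e) v w) (m≤m+n 1 _)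
    ... | no  p with *≢0 (δ (c₁ e) v) _ p
    ...   | _ , b with δ≢0 b
    -- Here `w` is `c₂ e`, so the second product can contribute only if `v` equals `w`.
    ...     | refl = +-mono-≤ (product≤1 (c₁ e) (c₂ e) v w)
                (≤-trans (*-monoʳ-≤ (δ (c₂ e) v) (δ≤1 (c₁ e) w)) (≤-reflexive (trans (*-identityʳ _) (δ-sym (c₂ e) v))))
      where
      δ-sym : ∀ a b → δ {m} a b ≡ δ b a
      δ-sym a b with a Fin.≟ b
      ... | yes refl = sym (δ-refl a)
      ... | no  ne   = sym (δ-≢ (ne ∘ sym))

    degree-incidence : ∀ v → degree v ≡ sum (λ w → sumE (incidence v w))
    degree-incidence v = sym (trans (sumE-comm (incidence v)) (sumE-cong (λ e → begin
      sum (λ w → incidence v w e)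
        ≡⟨ ∑-distrib-+ (λ w → δ (c₁ e) v * δ (c₂ e) w) _ ⟩
      sum (λ w → δ (c₁ e) v * δ (c₂ e) w) + sum (λ w → δ (c₂ e) v * δ (c₁ e) w)
        ≡⟨ cong₂ _+_ (row (δ (c₁ e) v) (c₂ e)) (row (δ (c₂ e) v) (c₁ e)) ⟩
      δ (c₁ e) v + δ (c₂ e) v ∎)))
      where
      open ≡-Reasoning
      row : ∀ x a → sum (λ w → x * δ {m} a w) ≡ x
      row x a = trans (sym (*-distribˡ-sum x (δ a))) (trans (cong (x *_) (sum-δ a)) (*-identityʳ x))

  -- For each colour `w` at most one edge has label {v, w}; it contributes at most one to the
  -- degree, or two if it is the loop at `v`.
  degree≤ : ∀ v → degree v ≤ suc m
  degree≤ v = begin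
    degree v                               ≡⟨ degree-incidence v ⟩
    sum (λ w → sumE (incidence v w))
      ≤⟨ sum-mono (λ w → sumE≤-support (incidence v w) (1 + δ v w) (incidence≤ v w)
           (λ e f p q → distinguishing e f (same e f (incidence≢0 v w e p) (incidence≢0 v w f q)))) ⟩
    sum (λ w → 1 + δ v w)                  ≡⟨ ∑-distrib-+ (λ _ → 1) (δ v) ⟩
    sum {m} (λ _ → 1) + sum (δ v)          ≡⟨ cong₂ _+_ (trans (sum-const m 1) (*-identityʳ m)) (sum-δ v) ⟩
    m + 1                                  ≡⟨ +-comm m 1 ⟩
    suc m                                  ∎
    where open ≤-Reasoning

  leaves : Fin m → ℕ
  leaves v = sum (λ i → δ (leaf i) v)

  -- The centre is an end of four edges and every inner vertex of a leg an end of two; only the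
  -- leaves are ends of a single edge.
  degree-parity : ∀ v → ∃ λ X → degree v ≡ leaves v + 2 * X
  degree-parity v = 2 * x + sum X , (begin
    degree v                                          ≡⟨ sum-cong-≗ (λ i → proj₂ (leg i)) ⟩
    sum (λ i → x + δ (leaf i) v + 2 * X i)            ≡⟨ arith x (δ (leaf 0F) v) (δ (leaf 1F) v) (δ (leaf 2F) v) (δ (leaf 3F) v) (X 0F) (X 1F) (X 2F) (X 3F) ⟩
    leaves v + 2 * (2 * x + sum X)                    ∎)
    where
    open ≡-Reasoning
    x = δ centre v
    leg = λ i → leg-parity (pos i) (λ w → δ (c (Maybe.map (i ,_) w)) v)
    X : Fin 4 → ℕ
    X i = proj₁ (leg i)
    arith : ∀ x p q r s a b c d →
      (x + p + 2 * a) + ((x + q + 2 * b) + ((x + r + 2 * c) + ((x + s + 2 * d) + 0))) ≡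
      (p + (q + (r + (s + 0)))) + 2 * (2 * x + (a + (b + (c + (d + 0)))))
    arith = solve-∀

  2*size≤ : 2 * size ≤ m * suc m
  2*size≤ = ≤-trans (≤-reflexive (sym sum-degree)) (≤-trans (sum-mono degree≤) (≤-reflexive (sum-const m (suc m))))

  -- A colour without leaves has even degree, hence degree at most `m` because `suc m` is odd. The
  -- other colours may exceed `m` by one, and the leaf counts sum to four.
  2*size≤-even : ∀ j → m ≡ 2 * j → 2 * size ≤ m * m + 4
  2*size≤-even j m≡2j = begin
    2 * size                                ≡⟨ sum-degree ⟨
    sum degree                              ≤⟨ sum-mono bound ⟩
    sum (λ v → m + leaves v)                ≡⟨ ∑-distrib-+ (λ _ → m) leaves ⟩
    sum {m} (λ _ → m) + sum leaves          ≡⟨ cong₂ _+_ (sum-const m m) (∑-comm (λ v i → δ (leaf i) v)) ⟩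
    m * m + sum (λ i → sum (δ (leaf i)))    ≡⟨ cong (m * m +_) (sum-cong-≗ (λ i → sum-δ (leaf i))) ⟩
    m * m + 4                               ∎
    where
    open ≤-Reasoning
    bound : ∀ v → degree v ≤ m + leaves v
    bound v with leaves v in eq | degree-parity v
    ... | suc n | _     = ≤-trans (degree≤ v) (≤-trans (m≤m+n (suc m) n) (≤-reflexive (sym (+-suc m n))))
    ... | zero  | X , p = ≤-trans (≤-trans (≤-reflexive p) 2X≤m) (≤-reflexive (sym (+-identityʳ m)))
      where
      2X≤m : 2 * X ≤ m
      2X≤m = subst (2 * X ≤_) (sym m≡2j) (*-monoʳ-≤ 2 (≤-pred (*-cancelˡ-< 2 X (suc j)
        (≤-trans (s≤s (subst₂ (λ a b → a ≤ suc b) p m≡2j (degree≤ v))) (≤-reflexive (arith j))))))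
        where
        arith : ∀ j → suc (suc (2 * j)) ≡ 2 * suc j
        arith = solve-∀

  private
    singleLeaf : ∀ i → (∀ i′ → leaf i′ ≡ leaf i → i′ ≡ i) → leaves (leaf i) ≡ 1
    singleLeaf i uniq = trans (sum-single (λ i′ → δ (leaf i′) (leaf i)) i (λ i′ ne → δ-≢ (ne ∘ uniq i′))) (δ-refl (leaf i))

  -- The colour of a single leaf has odd degree and so misses the even bound `suc m`. The leaves `a`
  -- and `b` give two such colours.
  2*size≤-odd : ∀ j → m ≡ suc (2 * j) → ∀ a b → leaf a ≢ leaf b →
    (∀ i → leaf i ≡ leaf a → i ≡ a) → (∀ i → leaf i ≡ leaf b → i ≡ b) → 2 * size + 2 ≤ m * suc m
  2*size≤-odd j m≡ a b a≢b ua ub = begin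
    2 * size + 2                                             ≡⟨ cong₂ _+_ (sym sum-degree) (sym (trans (∑-distrib-+ (δ (leaf a)) (δ (leaf b))) (cong₂ _+_ (sum-δ (leaf a)) (sum-δ (leaf b))))) ⟩
    sum degree + sum (λ v → δ (leaf a) v + δ (leaf b) v)     ≡⟨ ∑-distrib-+ degree (λ v → δ (leaf a) v + δ (leaf b) v) ⟨
    sum (λ v → degree v + (δ (leaf a) v + δ (leaf b) v))     ≤⟨ sum-mono bound ⟩
    sum {m} (λ v → suc m)                                    ≡⟨ sum-const m (suc m) ⟩
    m * suc m                                                ∎
    where
    open ≤-Reasoning
    odd : ∀ v → leaves v ≡ 1 → degree v + 1 ≤ suc m
    odd v l≡1 with degree-parity v
    ... | X , p = subst₂ _≤_ (sym (trans (cong (_+ 1) (trans p (cong (_+ 2 * X) l≡1))) (arith₁ X))) (sym (trans (cong suc m≡) (arith₂ j)))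
          (*-monoʳ-≤ 2 (*-cancelˡ-< 2 X (suc j) (subst₂ _≤_ (trans p (cong (_+ 2 * X) l≡1)) (trans (cong suc m≡) (arith₂ j)) (degree≤ v))))
      where
      arith₁ : ∀ X → 1 + 2 * X + 1 ≡ 2 * suc X
      arith₁ = solve-∀
      arith₂ : ∀ j → suc (suc (2 * j)) ≡ 2 * suc j
      arith₂ = solve-∀
    bound : ∀ v → degree v + (δ (leaf a) v + δ (leaf b) v) ≤ suc m
    bound v with leaf a Fin.≟ v | leaf b Fin.≟ v
    ... | yes p    | yes q    = ⊥-elim (a≢b (trans p (sym q)))
    ... | yes refl | no _     = odd v (singleLeaf a ua)
    ... | no _     | yes refl = odd v (singleLeaf b ub)
    ... | no _     | no _     = ≤-trans (≤-reflexive (+-identityʳ _)) (degree≤ v)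

  private
    head≢⇒5≤m : ∀ x → (∀ i → x ≢ head i) → 5 ≤ m
    head≢⇒5≤m x fresh = injective⇒≤ injective
      where
      f : Fin 5 → Fin m
      f Fin.zero    = x
      f (Fin.suc i) = head i
      injective : ∀ {i j} → f i ≡ f j → i ≡ j
      injective {Fin.zero}  {Fin.zero}  eq = refl
      injective {Fin.zero}  {Fin.suc j} eq = ⊥-elim (fresh j eq)
      injective {Fin.suc i} {Fin.zero}  eq = ⊥-elim (fresh i (sym eq))
      injective {Fin.suc i} {Fin.suc j} eq = cong Fin.suc (head-injective eq)

  -- The heads have four colours, and the centre gives a fifth unless some first edge is a loop. In
  -- that case the second edge of that leg also starts at the colour of the centre, so its other end
  -- differs in colour from every head.
  5≤m : (∀ i → 2 ≤ ℓ i) → 5 ≤ m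
  5≤m long with any? (λ i → head i Fin.≟ centre)
  ... | no none        = head≢⇒5≤m centre (λ i eq → none (i , sym eq))
  ... | yes (i , loop) = head≢⇒5≤m (c (just (i , j₂))) fresh
    where
    j₂ = proj₁ (second (long i))
    c₁-second : c₁ (i , j₂) ≡ centre
    c₁-second = trans (cong (c ∘ Maybe.map (i ,_)) (proj₁ (proj₂ (second (long i)))))
      (trans (cong (λ p → c (just (i , first p))) (≤-irrelevant _ (pos i))) loop)
    j₂-index : ∀ k j → _≡_ {A = E G} (i , j₂) (k , j) → ∀ q → j ≢ first q
    j₂-index k j refl = proj₂ (proj₂ (second (long i)))
    fresh : ∀ k → c (just (i , j₂)) ≢ head k
    fresh k eq = j₂-index k (first (pos k))
      (distinguishing (i , j₂) (k , first (pos k)) (inj₁ (trans c₁-second (sym (c₁-first k)) , eq))) (pos k) refl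

-- Values

-- When the fuel runs out the bound is returned untested, so the test is assumed to succeed there.
leastFrom-sound : ∀ (p : ℕ → Bool) from fuel → T (p (from + fuel)) → T (p (leastFrom p from fuel))
leastFrom-sound p from zero       t = subst (T ∘ p) (+-identityʳ from) t
leastFrom-sound p from (suc fuel) t with p from in eq
... | true  = subst T (sym eq) _
... | false = leastFrom-sound p (suc from) fuel (subst (T ∘ p) (+-suc from fuel) t)

leastFrom-least : ∀ (p : ℕ → Bool) from fuel {j} → from ≤ j → T (p j) → leastFrom p from fuel ≤ j
leastFrom-least p from zero       from≤j t = from≤j
leastFrom-least p from (suc fuel) from≤j t with p from in eq
... | true  = from≤j
... | false = leastFrom-least p (suc from) fuel (≤∧≢⇒< from≤j λ { refl → subst T eq t }) t

n≤n*n : ∀ n → n ≤ n * n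
n≤n*n zero    = z≤n
n≤n*n (suc n) = m≤m*n (suc n) (suc n)

ceilSqrt-sound : ∀ n → n ≤ ceilSqrt n * ceilSqrt n
ceilSqrt-sound n = ≤ᵇ⇒≤ _ _ (leastFrom-sound (λ k → n ≤ᵇ k * k) 0 n (≤⇒≤ᵇ (n≤n*n n)))

ceilSqrt-least : ∀ n {j} → n ≤ j * j → ceilSqrt n ≤ j
ceilSqrt-least n n≤ = leastFrom-least (λ k → n ≤ᵇ k * k) 0 n z≤n (≤⇒≤ᵇ n≤)

module _ (x n : ℕ) (x≡ : x ≡ 4 * n + 1) where
  private
    K = ceilHalfSqrtMinus1 x
    square : ∀ k → (2 * k + 1) * (2 * k + 1) ≡ 4 * (k * suc k) + 1
    square = solve-∀
    x≤ : x ≤ (2 * x + 1) * (2 * x + 1)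
    x≤ = ≤-trans (≤-trans (m≤m+n x _) (m≤m+n (2 * x) 1)) (n≤n*n (2 * x + 1))

  -- Since (2k + 1)² = 4k(k + 1) + 1, the number `K` is the least k with n ≤ k(k + 1).
  ceilHalf-sound : n ≤ K * suc K
  ceilHalf-sound = *-cancelˡ-≤ 4 (+-cancelʳ-≤ 1 _ _ (subst₂ _≤_ x≡ (square K)
    (≤ᵇ⇒≤ _ _ (leastFrom-sound (λ k → x ≤ᵇ (2 * k + 1) * (2 * k + 1)) 0 x (≤⇒≤ᵇ x≤)))))

  ceilHalf-least : ∀ {j} → n ≤ j * suc j → K ≤ j
  ceilHalf-least {j} n≤ = leastFrom-least (λ k → x ≤ᵇ (2 * k + 1) * (2 * k + 1)) 0 x z≤n
    (≤⇒≤ᵇ (subst₂ _≤_ (sym x≡) (sym (square j)) (+-monoˡ-≤ 1 (*-monoʳ-≤ 4 n≤))))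

Even Odd : ℕ → Set
Even m = ∃ λ j → m ≡ j * 2
Odd m  = ∃ λ j → m ≡ suc (j * 2)

%2≡0⇒Even : ∀ m → m % 2 ≡ 0 → Even m
%2≡0⇒Even m eq = m / 2 , trans (m≡m%n+[m/n]*n m 2) (cong (_+ m / 2 * 2) eq)

%2≡1⇒Odd : ∀ m → m % 2 ≡ 1 → Odd m
%2≡1⇒Odd m eq = m / 2 , trans (m≡m%n+[m/n]*n m 2) (cong (_+ m / 2 * 2) eq)

even⊎odd : ∀ m → Even m ⊎ Odd m
even⊎odd m with m % 2 in eq | m%n<n m 2
... | 0 | _ = inj₁ (%2≡0⇒Even m eq)
... | 1 | _ = inj₂ (%2≡1⇒Odd m eq)
... | suc (suc _) | s≤s (s≤s ())

-- Odd m are governed by N ≤ m(m + 1) and even m by 2e ≤ m² + 4. Taking `N` as 2e or 2e + 2 covers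
-- both families of spiders; `K` and `S` are the least numbers satisfying the two inequalities.
module Value (G : Graph) (e N : ℕ) (11≤e : 11 ≤ e) (2e≤N : 2 * e ≤ N) (N≤2e+2 : N ≤ 2 * e + 2)
  (lowerOdd  : ∀ m → Odd m → EDColorable G m → N ≤ m * suc m)
  (lowerEven : ∀ m → Even m → EDColorable G m → 2 * e ≤ m * m + 4)
  (upperOdd  : ∀ i → N ≤ suc ((2 + i) * 2) * suc (suc ((2 + i) * 2)) → EDColorable G (suc ((2 + i) * 2)))
  (upperEven : ∀ i → 2 * e ≤ (3 + i) * 2 * ((3 + i) * 2) + 4 → EDColorable G ((3 + i) * 2))
  (x : ℕ) (x≡ : x ≡ 4 * N + 1)
  where
  private
    K = ceilHalfSqrtMinus1 x
    S = ceilSqrt (2 * e ∸ 4)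

    22≤2e : 22 ≤ 2 * e
    22≤2e = *-monoʳ-≤ 2 11≤e

    -- Four colours give only 4² + 4 = 20, less than 22.
    even≥6 : ∀ j → 2 * e ≤ j * 2 * (j * 2) + 4 → ∃ λ i → j ≡ 3 + i
    even≥6 0 b with () ← ≤⇒≤ᵇ (≤-trans 22≤2e b)
    even≥6 1 b with () ← ≤⇒≤ᵇ (≤-trans 22≤2e b)
    even≥6 2 b with () ← ≤⇒≤ᵇ (≤-trans 22≤2e b)
    even≥6 (suc (suc (suc i))) b = i , refl

    -- As m is at least 6, m² + m is at least m² + 6 and the even bound implies the odd one. Hence
    -- an odd `K` cannot be undercut by an even number of colours.
    K≤even : ∀ m → Even m → EDColorable G m → K ≤ m
    K≤even m (j , refl) col with even≥6 j (lowerEven m (j , refl) col)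
    ... | i , refl = ceilHalf-least x N x≡ (begin
      N                    ≤⟨ N≤2e+2 ⟩
      2 * e + 2            ≤⟨ +-monoˡ-≤ 2 (lowerEven m (j , refl) col) ⟩
      m * m + 4 + 2        ≡⟨ +-assoc (m * m) 4 2 ⟩
      m * m + 6            ≤⟨ +-monoʳ-≤ (m * m) (m≤m+n 6 (i * 2)) ⟩
      m * m + m            ≡⟨ trans (+-comm (m * m) m) (sym (*-suc m m)) ⟩
      m * suc m            ∎)
      where open ≤-Reasoning

    K≤ : ∀ m → EDColorable G m → K ≤ m
    K≤ m col with even⊎odd m
    ... | inj₁ even = K≤even m even col
    ... | inj₂ odd  = ceilHalf-least x N x≡ (lowerOdd m odd col)

  valueOdd : K % 2 ≡ 1 → IsEDChromaticNumber G K
  valueOdd K%2 with %2≡1⇒Odd K K%2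
  ... | j , K≡ = subst (1 ≤_) (sym K≡) (s≤s z≤n) , subst (EDColorable G) (sym K≡) (colour j N≤) , λ m _ → K≤ m
    where
    N≤ : N ≤ suc (j * 2) * suc (suc (j * 2))
    N≤ = subst (λ k → N ≤ k * suc k) K≡ (ceilHalf-sound x N x≡)
    22≤N = ≤-trans 22≤2e 2e≤N
    colour : ∀ j → N ≤ suc (j * 2) * suc (suc (j * 2)) → EDColorable G (suc (j * 2))
    colour 0 b with () ← ≤⇒≤ᵇ (≤-trans 22≤N b)
    colour 1 b with () ← ≤⇒≤ᵇ (≤-trans 22≤N b)
    colour (suc (suc i)) b = upperOdd i b

  private
    2e≤S²+4 : 2 * e ≤ S * S + 4
    2e≤S²+4 = ≤-trans (≤-reflexive (sym (m∸n+n≡m (≤-trans (m≤m+n 4 18) 22≤2e)))) (+-monoˡ-≤ 4 (ceilSqrt-sound (2 * e ∸ 4)))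

    S-least : ∀ j → 2 * e ≤ j * j + 4 → S ≤ j
    S-least j b = ceilSqrt-least (2 * e ∸ 4) (≤-trans (∸-monoˡ-≤ 4 b) (≤-reflexive (m+n∸n≡m (j * j) 4)))

    colourEven : ∀ j → 2 * e ≤ j * 2 * (j * 2) + 4 → EDColorable G (j * 2)
    colourEven j b with even≥6 j b
    ... | i , refl = upperEven i b

    colourOdd : ∀ j → 2 * e ≤ suc (j * 2) * suc (j * 2) + 4 → EDColorable G (suc (j * 2))
    colourOdd 0 b with () ← ≤⇒≤ᵇ (≤-trans 22≤2e b)
    colourOdd 1 b with () ← ≤⇒≤ᵇ (≤-trans 22≤2e b)
    -- The bound 2e ≤ 5² + 4 = 29 improves to 2e ≤ 28 by parity, and then N ≤ 30 = 5 · 6.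
    colourOdd 2 b = upperOdd 0 (≤-trans N≤2e+2 (+-monoˡ-≤ 2 (*-monoʳ-≤ 2 (≤-pred (*-cancelˡ-< 2 e 15 (s≤s b))))))
    colourOdd (suc (suc (suc i))) b = upperOdd (suc i) (begin
      N                    ≤⟨ N≤2e+2 ⟩
      2 * e + 2            ≤⟨ +-monoˡ-≤ 2 b ⟩
      m * m + 4 + 2        ≡⟨ +-assoc (m * m) 4 2 ⟩
      m * m + 6            ≤⟨ +-monoʳ-≤ (m * m) (m≤m+n 6 (suc (i * 2))) ⟩
      m * m + (6 + suc (i * 2))   ≡⟨ cong (m * m +_) (+-suc 6 (i * 2)) ⟩
      m * m + m            ≡⟨ trans (+-comm (m * m) m) (sym (*-suc m m)) ⟩
      m * suc m            ∎)
      where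
      open ≤-Reasoning
      m = suc ((3 + i) * 2)

    colourS : EDColorable G S
    colourS with even⊎odd S
    ... | inj₁ (j , S≡) = subst (EDColorable G) (sym S≡) (colourEven j (subst (λ s → 2 * e ≤ s * s + 4) S≡ 2e≤S²+4))
    ... | inj₂ (j , S≡) = subst (EDColorable G) (sym S≡) (colourOdd j (subst (λ s → 2 * e ≤ s * s + 4) S≡ 2e≤S²+4))

    1≤S : 1 ≤ S
    1≤S = n≢0⇒n>0 λ S≡0 → ⊥-elim (<⇒≱ (≤-trans (m≤m+n 5 17) 22≤2e) (subst (λ s → 2 * e ≤ s * s + 4) S≡0 2e≤S²+4))

  valueEven : K % 2 ≡ 0 → IsEDChromaticNumber G S
  valueEven K%2 = 1≤S , colourS , lower
    where
    S≤1+K : S ≤ suc K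
    S≤1+K = S-least (suc K) (≤-trans (≤-trans 2e≤N (ceilHalf-sound x N x≡))
      (≤-trans (*-monoˡ-≤ (suc K) (n≤1+n K)) (m≤m+n _ 4)))
    lower : ∀ m → 1 ≤ m → EDColorable G m → S ≤ m
    lower m _ col with even⊎odd m
    ... | inj₁ even = S-least m (lowerEven m even col)
    -- An odd m is at least `K` and differs from the even `K`, so it is at least `suc K`, which
    -- already satisfies the inequality defining `S`.
    ... | inj₂ odd@(j , m≡) = ≤-trans S≤1+K (≤∧≢⇒< (ceilHalf-least x N x≡ (lowerOdd m odd col)) K≢m)
      where
      K≢m : K ≢ m
      K≢m K≡m = let i , K≡ = %2≡0⇒Even K K%2 in even≢odd i j (trans (*-comm 2 i) (trans (sym K≡) (trans K≡m (trans m≡ (cong suc (*-comm j 2))))))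

-- The two families of spiders

oddSize-double : ∀ i → suc ((2 + i) * 2) * suc (suc ((2 + i) * 2)) ≡ 2 * (suc ((2 + i) * 2) * suc (2 + i))
oddSize-double = solve-∀

module _ {l₁ l₂ l₃ l₄} (1≤l₁ : 1 ≤ l₁) (l₁≤l₂ : l₁ ≤ l₂) (l₂≤l₃ : l₂ ≤ l₃) (l₃≤l₄ : l₃ ≤ l₄) where
  private
    e = l₁ + l₂ + l₃ + l₄
    G = Spider l₁ l₂ l₃ l₄
    1≤l₂ = ≤-trans 1≤l₁ l₁≤l₂
    1≤l₃ = ≤-trans 1≤l₂ l₂≤l₃

  positive : ∀ i → 1 ≤ legs l₁ l₂ l₃ l₄ i
  positive 0F = 1≤l₁
  positive 1F = 1≤l₂
  positive 2F = 1≤l₃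
  positive 3F = ≤-trans 1≤l₃ l₃≤l₄

  colour≥4 : ∀ m → 1 ≤ m → EDColorable G m → 4 ≤ m
  colour≥4 m _ col = Colouring.4≤m {m} {l₁} {l₂} {l₃} {l₄} positive col

  evenBound : ∀ m → Even m → EDColorable G m → 2 * e ≤ m * m + 4
  evenBound m (j , m≡) col = Colouring.2*size≤-even {m} {l₁} {l₂} {l₃} {l₄} positive col j (trans m≡ (*-comm j 2))

  evenColouring′ : ∀ i → 2 * e ≤ (3 + i) * 2 * ((3 + i) * 2) + 4 → EDColorable G ((3 + i) * 2)
  evenColouring′ i b = evenColouring i 1≤l₁ l₁≤l₂ l₂≤l₃ l₃≤l₄ (*-cancelˡ-≤ 2 (≤-trans b (≤-reflexive (arith i))))
    where
    arith : ∀ i → (3 + i) * 2 * ((3 + i) * 2) + 4 ≡ 2 * ((3 + i) * 2 * (3 + i) + 2)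
    arith = solve-∀

  wideValue : 2 ≤ l₃ → 11 ≤ e →
      (ceilHalfSqrtMinus1 (8 * e + 1) % 2 ≡ 1 → IsEDChromaticNumber G (ceilHalfSqrtMinus1 (8 * e + 1)))
    × (ceilHalfSqrtMinus1 (8 * e + 1) % 2 ≡ 0 → IsEDChromaticNumber G (ceilSqrt (2 * e ∸ 4)))
  wideValue 2≤l₃ 11≤e = V.valueOdd , V.valueEven
    where
    scale : ∀ e → 8 * e + 1 ≡ 4 * (2 * e) + 1
    scale = solve-∀
    module V = Value G e (2 * e) 11≤e ≤-refl (m≤m+n _ 2)
      (λ m _ col → Colouring.2*size≤ {m} {l₁} {l₂} {l₃} {l₄} positive col) evenBound
      (λ i b → oddColouring i 1≤l₁ 1≤l₂ 2≤l₃ l₃≤l₄ (*-cancelˡ-≤ 2 (≤-trans b (≤-reflexive (oddSize-double i)))))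
      evenColouring′ (8 * e + 1) (scale e)

-- The leaves of the three short legs are heads and so have distinct colours. The fourth leaf shares
-- its colour with at most one of them, which leaves two colours of single leaves.
oddBound₁ : ∀ {l} → 1 ≤ l → ∀ m → Odd m → EDColorable (Spider 1 1 1 l) m → 2 * (3 + l) + 2 ≤ m * suc m
oddBound₁ {l} 1≤l m (j , m≡) col = pick
  where
  pos : ∀ i → 1 ≤ legs 1 1 1 l i
  pos = positive ≤-refl ≤-refl ≤-refl 1≤l
  open Colouring {m} {1} {1} {1} {l} pos col
  bound = 2*size≤-odd j (trans m≡ (cong suc (*-comm j 2)))
  leaf₃-unique : ∀ a → (leaf a ≡ head a) → leaf 3F ≢ leaf a → ∀ i → leaf i ≡ leaf a → i ≡ a
  leaf₃-unique a short ne 0F eq = head-injective (trans eq short)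
  leaf₃-unique a short ne 1F eq = head-injective (trans eq short)
  leaf₃-unique a short ne 2F eq = head-injective (trans eq short)
  leaf₃-unique a short ne 3F eq = ⊥-elim (ne eq)
  0≢1 : leaf 0F ≢ leaf 1F
  0≢1 eq with () ← head-injective {0F} {1F} eq
  0≢2 : leaf 0F ≢ leaf 2F
  0≢2 eq with () ← head-injective {0F} {2F} eq
  1≢2 : leaf 1F ≢ leaf 2F
  1≢2 eq with () ← head-injective {1F} {2F} eq
  pick : 2 * (3 + l) + 2 ≤ m * suc m
  pick with leaf 3F Fin.≟ leaf 0F | leaf 3F Fin.≟ leaf 1F
  ... | no ≢0  | no ≢1  = bound 0F 1F 0≢1 (leaf₃-unique 0F refl ≢0) (leaf₃-unique 1F refl ≢1)
  ... | yes ≡0 | _      = bound 1F 2F 1≢2 (leaf₃-unique 1F refl (λ ≡1 → 0≢1 (trans (sym ≡0) ≡1)))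
                                          (leaf₃-unique 2F refl (λ ≡2 → 0≢2 (trans (sym ≡0) ≡2)))
  ... | no ≢0  | yes ≡1 = bound 0F 2F 0≢2 (leaf₃-unique 0F refl ≢0)
                                          (leaf₃-unique 2F refl (λ ≡2 → 1≢2 (trans (sym ≡1) ≡2)))

narrowValue : ∀ {l} → 1 ≤ l → 11 ≤ 3 + l →
    (ceilHalfSqrtMinus1 (8 * (3 + l) + 9) % 2 ≡ 1 → IsEDChromaticNumber (Spider 1 1 1 l) (ceilHalfSqrtMinus1 (8 * (3 + l) + 9)))
  × (ceilHalfSqrtMinus1 (8 * (3 + l) + 9) % 2 ≡ 0 → IsEDChromaticNumber (Spider 1 1 1 l) (ceilSqrt (2 * (3 + l) ∸ 4)))
narrowValue {l} 1≤l 11≤e = V.valueOdd , V.valueEven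
  where
  e = 3 + l
  scale : ∀ e → 8 * e + 9 ≡ 4 * (2 * e + 2) + 1
  scale = solve-∀
  double : ∀ l → 2 * (4 + l) ≡ 2 * (3 + l) + 2
  double = solve-∀
  module V = Value (Spider 1 1 1 l) e (2 * e + 2) 11≤e (m≤m+n _ 2) ≤-refl
    (oddBound₁ 1≤l) (evenBound ≤-refl ≤-refl ≤-refl 1≤l)
    (λ i b → oddColouring₁ i l (*-cancelˡ-≤ 2 (≤-trans (≤-reflexive (double l)) (≤-trans b (≤-reflexive (oddSize-double i))))))
    (evenColouring′ ≤-refl ≤-refl ≤-refl 1≤l) (8 * e + 9) (scale e)

theorem4p3 : (l₁ l₂ l₃ l₄ : ℕ) → 1 ≤ l₁ → l₁ ≤ l₂ → l₂ ≤ l₃ → l₃ ≤ l₄ →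
    ((l₃ ≡ 1 →
    (l₁ + l₂ + l₃ + l₄ ≤ 10 → IsEDChromaticNumber (Spider 1 1 1 l₄) 4)
    × (11 ≤ l₁ + l₂ + l₃ + l₄ → ceilHalfSqrtMinus1 (8 * (l₁ + l₂ + l₃ + l₄) + 9) % 2 ≡ 1 →
    IsEDChromaticNumber (Spider 1 1 1 l₄) (ceilHalfSqrtMinus1 (8 * (l₁ + l₂ + l₃ + l₄) + 9)))
    × (11 ≤ l₁ + l₂ + l₃ + l₄ → ceilHalfSqrtMinus1 (8 * (l₁ + l₂ + l₃ + l₄) + 9) % 2 ≡ 0 →
    IsEDChromaticNumber (Spider 1 1 1 l₄) (ceilSqrt (2 * (l₁ + l₂ + l₃ + l₄) ∸ 4))))
    × (2 ≤ l₃ →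
    (l₁ + l₂ + l₃ + l₄ ≤ 10 → l₁ ≡ 1 → IsEDChromaticNumber (Spider l₁ l₂ l₃ l₄) 4)
    × (l₁ + l₂ + l₃ + l₄ ≤ 10 → l₁ ≡ 2 → IsEDChromaticNumber (Spider l₁ l₂ l₃ l₄) 5)
    × (11 ≤ l₁ + l₂ + l₃ + l₄ → ceilHalfSqrtMinus1 (8 * (l₁ + l₂ + l₃ + l₄) + 1) % 2 ≡ 1 →
    IsEDChromaticNumber (Spider l₁ l₂ l₃ l₄) (ceilHalfSqrtMinus1 (8 * (l₁ + l₂ + l₃ + l₄) + 1)))
    × (11 ≤ l₁ + l₂ + l₃ + l₄ → ceilHalfSqrtMinus1 (8 * (l₁ + l₂ + l₃ + l₄) + 1) % 2 ≡ 0 →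
    IsEDChromaticNumber (Spider l₁ l₂ l₃ l₄) (ceilSqrt (2 * (l₁ + l₂ + l₃ + l₄) ∸ 4)))))
theorem4p3 l₁ l₂ l₃ l₄ 1≤l₁ l₁≤l₂ l₂≤l₃ l₃≤l₄ = narrow , λ 2≤l₃ →
    (λ { e≤10 refl → s≤s z≤n , fourColouring l₂ l₃ l₄ l₁≤l₂ l₂≤l₃ l₃≤l₄ (≤-pred e≤10) , colour≥4 1≤l₁ l₁≤l₂ l₂≤l₃ l₃≤l₄ })
  -- Five colours provide fifteen labels, and with l₁ = 2 every leg has a second edge, as `5≤m`
  -- requires.
  , (λ { e≤10 refl → s≤s z≤n , oddColouring 0 1≤l₁ (≤-trans 1≤l₁ l₁≤l₂) 2≤l₃ l₃≤l₄ (≤-trans e≤10 (m≤m+n 10 5)) , λ m _ col →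
        Colouring.5≤m {m} {2} {l₂} {l₃} {l₄} (positive 1≤l₁ l₁≤l₂ l₂≤l₃ l₃≤l₄) col
          (λ { 0F → ≤-refl ; 1F → l₁≤l₂ ; 2F → 2≤l₃ ; 3F → ≤-trans 2≤l₃ l₃≤l₄ }) })
  , (λ 11≤e → proj₁ (wideValue 1≤l₁ l₁≤l₂ l₂≤l₃ l₃≤l₄ 2≤l₃ 11≤e))
  , (λ 11≤e → proj₂ (wideValue 1≤l₁ l₁≤l₂ l₂≤l₃ l₃≤l₄ 2≤l₃ 11≤e))
  where
  narrow : l₃ ≡ 1 → _
  narrow refl with ≤-antisym l₂≤l₃ (≤-trans 1≤l₁ l₁≤l₂)
  ... | refl with ≤-antisym l₁≤l₂ 1≤l₁
  ... | refl =
      (λ e≤10 → s≤s z≤n , fourColouring 1 1 l₄ ≤-refl ≤-refl l₃≤l₄ (≤-pred e≤10) , colour≥4 ≤-refl ≤-refl ≤-refl l₃≤l₄)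
    , (λ 11≤e → proj₁ (narrowValue l₃≤l₄ 11≤e))
    , (λ 11≤e → proj₂ (narrowValue l₃≤l₄ 11≤e))
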